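{- Let $q=2^n$ with $n\ge 5$, and let \[ f(X)=aX^2+bX+\frac{1}{X-r}+\frac{1}{X-r^q}, \] where $a\in\mathbb{F}_q^*$, $b\in\mathbb{F}_2$ and $r\in\mathbb{F}_{q^2}\setminus\mathbb{F}_q$. Then $f$ is not a permutation rational function of $\mathbb{P}^1(\mathbb{F}_q)$.
   Context: $\mathbb{P}^1(\mathbb{F}_q)=\mathbb{F}_q\cup\{\infty\}$ is the projective line over $\mathbb{F}_q$. A rational function $f=P/Q\in\mathbb{F}_q(X)$ ($P,Q$ coprime) defines a map $\mathbb{P}^1(\mathbb{F}_q)\to\mathbb{P}^1(\mathbb{F}_q)$ in the usual way (zeros of $Q$ map to $\infty$, and $f(\infty)$ is the limiting value). A permutation rational function of $\mathbb{P}^1(\mathbb{F}_q)$ is a rational function whose induced map on $\mathbb{P}^1(\mathbb{F}_q)$ is a bijection. -}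

module Defs where

open import Level using (0ℓ)
open import Data.Nat as ℕ using (ℕ; zero; suc)
open import Data.Fin using (Fin)
import Data.Fin as Fin
open import Data.Unit using (⊤)
open import Data.Maybe using (Maybe; just; nothing)
open import Data.Product using (Σ; ∃; _×_; _,_)
open import Relation.Binary.PropositionalEquality using (_≡_; _≢_; cong; sym; trans)
open import Relation.Nullary using (Dec; yes; no)
open import Algebra.Structures using (IsCommutativeRing)
open import Function.Bundles using (_↔_; Inverse)

-- A field, with propositional equality.  The multiplicative inverse is a
-- total function whose value at 0 is irrelevant (only used at nonzero
-- arguments); the field axiom is  x ≢ 0 → x * x ⁻¹ ≡ 1.
record Field : Set₁ where
  infixl 7 _*_
  infixl 6 _+_ _-_
  infix  8 -_
  infix  9 _⁻¹
  field
    Carrier : Set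
    _+_ _*_ : Carrier → Carrier → Carrier
    -_ : Carrier → Carrier
    0# 1# : Carrier
    _⁻¹ : Carrier → Carrier
    isCommutativeRing : IsCommutativeRing _≡_ _+_ _*_ -_ 0# 1#
    0≢1 : 0# ≢ 1#
    inverseʳ : ∀ x → x ≢ 0# → x * x ⁻¹ ≡ 1#

  _-_ : Carrier → Carrier → Carrier
  x - y = x + (- y)

  infixr 10 _^_
  _^_ : Carrier → ℕ → Carrier
  x ^ zero  = 1#
  x ^ suc k = x * (x ^ k)

record FiniteField (m : ℕ) : Set₁ where
  field
    field' : Field
  open Field field' public
  field
    enum : Carrier ↔ Fin m

  _≟_ : (x y : Carrier) → Dec (x ≡ y)
  x ≟ y with Inverse.to enum x Fin.≟ Inverse.to enum y
  ... | yes p = yes (trans (sym (Inverse.strictlyInverseʳ enum x))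
                      (trans (cong (Inverse.from enum) p) (Inverse.strictlyInverseʳ enum y)))
  ... | no ¬p = no (λ e → ¬p (cong (Inverse.to enum) e))

module _ {m : ℕ} (E : FiniteField m) where
  open FiniteField E

  -- The projective line over E: nothing = ∞, just x = the finite point x.
  P¹ : Set
  P¹ = Maybe Carrier

  -- Membership in the subfield F_q = { x ∈ E | x^q = x } (q given).
  InSubfield : ℕ → Carrier → Set
  InSubfield q x = x ^ q ≡ x

  InP¹Sub : ℕ → P¹ → Set
  InP¹Sub q nothing  = ⊤
  InP¹Sub q (just x) = InSubfield q x

  PermutesP¹Sub : ℕ → (P¹ → P¹) → Set
  PermutesP¹Sub q F =
      (∀ p → InP¹Sub q p → InP¹Sub q (F p))
    × (∀ p p' → InP¹Sub q p → InP¹Sub q p' → F p ≡ F p' → p ≡ p')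
    × (∀ y → InP¹Sub q y → Σ P¹ (λ p → InP¹Sub q p × (F p ≡ y)))

  -- The map on P¹ induced by f(X) = aX² + bX + 1/(X-r) + 1/(X-s)
  -- (used with s = r^q ≠ r, a ≠ 0):
  --   * zeros of the reduced denominator (X-r)(X-s) (i.e. X = r or X = s)
  --     map to ∞  (there the numerator is nonzero as r ≠ s);
  --   * f(∞) = ∞, since a ≠ 0 so deg numerator (4) > deg denominator (2);
  --   * otherwise x ↦ a x² + b x + (x-r)⁻¹ + (x-s)⁻¹.
  fMap : (a b r s : Carrier) → P¹ → P¹
  fMap a b r s nothing = nothing
  fMap a b r s (just x) with x ≟ r | x ≟ s
  ... | yes _ | _     = nothing
  ... | no _  | yes _ = nothing
  ... | no _  | no _  =
    just (a * x ^ 2 + b * x + (x - r) ⁻¹ + (x - s) ⁻¹)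

{-# OPTIONS --safe #-}

-- Put F = F_q, t = r + r^q, ρ = r/t, A = a t³ and B = b t². Then ρ^q = ρ + 1, and if f permutes F then so
-- does t f(t X) = A X² + B X + 1/(X + ρ) + 1/(X + ρ + 1). Up to an additive constant this is
-- g = A u + ε z + 1/u with z = X + ρ, u = z² + z and ε = A + B. Hence the sum of g^k over F vanishes for
-- 1 ≤ k ≤ q - 2. On the other hand these sums can be computed: modulo z² = z + u every power of g is
-- z T(u) + H(u). The term H(u) is invariant under X ↦ X + 1 and sums to 0 (compare z H(u) with its
-- translate), polynomials of degree at most q - 2 sum to 0, and since z^q = z + 1 both 1/z^k and
-- 1/(z + 1)^k sum to 1 for 1 ≤ k ≤ q, from which the sum of z/u^k follows by Pascal's recursion.
-- The exponent k = 3 gives ε² + ε = 0. If ε = 0 then g takes equal values at X = 0 and X = 1.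
-- If ε = 1 the exponent k = 11 gives A = 0; as g¹¹ has degree 22, this requires q - 2 ≥ 22, whence n ≥ 5.

module Submission where

open import Defs
open import Level using (0ℓ)
open import Algebra.Bundles using (CommutativeRing; CommutativeMonoid)
open import Algebra.Solver.Ring.AlmostCommutativeRing using (fromCommutativeRing; _-Raw-AlmostCommutative⟶_)
import Algebra.Solver.Ring
import Algebra.Properties.CommutativeMonoid.Sum as MonoidSum
import Algebra.Properties.CommutativeSemigroup as CommutativeSemigroupProperties
import Algebra.Properties.Group as GroupProperties
import Algebra.Properties.Semiring.Mult as Mult
import Algebra.Properties.Semiring.Sum as SemiringSum
open import Data.Bool using (Bool; true; false; _xor_; _∧_; if_then_else_)
import Data.Bool.Properties as Bool
open import Data.Fin using (Fin; zero; suc; inject≤)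
open import Data.Fin.Permutation using (permutation)
import Data.Fin.Properties as Fin
open import Data.List using (List; []; _∷_; length)
open import Data.Maybe using (Maybe; just; nothing)
open import Data.Maybe.Properties using (just-injective)
open import Data.Nat as ℕ using (ℕ; zero; suc; _≤_; _<_; s≤s; z≤n)
import Data.Nat.Properties as ℕ
open import Data.Product using (Σ; _×_; _,_; proj₁; proj₂)
open import Data.Sum using (_⊎_)
open import Data.Vec using (Vec; []; _∷_; replicate)
open import Function using (_∘_; Inverse; Injective)
open import Relation.Binary.PropositionalEquality using (_≡_; _≢_; refl; sym; trans; cong; cong₂; subst; module ≡-Reasoning)
open import Relation.Nullary using (¬_; Dec; yes; no; contradiction)
open import Relation.Nullary.Decidable using (decidable-stable)

open ≡-Reasoning

-- Elementary arithmetic in a field.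

module FieldProperties (K : Field) where
  open Field K

  commutativeRing : CommutativeRing 0ℓ 0ℓ
  commutativeRing = record { isCommutativeRing = isCommutativeRing }

  open CommutativeRing commutativeRing public
    using ( +-assoc; +-comm; +-identityˡ; +-identityʳ; -‿inverseʳ
          ; *-assoc; *-comm; *-identityˡ; *-identityʳ; distribˡ; distribʳ; zeroˡ; zeroʳ
          ; semiring; +-group; +-commutativeMonoid; *-commutativeMonoid; *-commutativeSemigroup )

  open GroupProperties +-group public using () renaming (∙-cancelˡ to +-cancelˡ)

  x≢0∧xy≡0⇒y≡0 : ∀ {x y} → x ≢ 0# → x * y ≡ 0# → y ≡ 0#
  x≢0∧xy≡0⇒y≡0 {x} {y} x≢0 xy≡0 = begin
    y                ≡⟨ *-identityˡ y ⟨
    1# * y           ≡⟨ cong (_* y) (trans (*-comm (x ⁻¹) x) (inverseʳ x x≢0)) ⟨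
    x ⁻¹ * x * y     ≡⟨ *-assoc (x ⁻¹) x y ⟩
    x ⁻¹ * (x * y)   ≡⟨ cong (x ⁻¹ *_) xy≡0 ⟩
    x ⁻¹ * 0#        ≡⟨ zeroʳ (x ⁻¹) ⟩
    0#               ∎

  *-nonzero : ∀ {x y} → x ≢ 0# → y ≢ 0# → x * y ≢ 0#
  *-nonzero x≢0 y≢0 xy≡0 = y≢0 (x≢0∧xy≡0⇒y≡0 x≢0 xy≡0)

  *-cancelʳ : ∀ {x y z} → z ≢ 0# → x * z ≡ y * z → x ≡ y
  *-cancelʳ {x} {y} {z} z≢0 xz≡yz = begin
    x               ≡⟨ expand x ⟩
    x * z * z ⁻¹    ≡⟨ cong (_* z ⁻¹) xz≡yz ⟩
    y * z * z ⁻¹    ≡⟨ expand y ⟨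
    y               ∎
    where
    expand : ∀ w → w ≡ w * z * z ⁻¹
    expand w = sym (trans (*-assoc w z (z ⁻¹)) (trans (cong (w *_) (inverseʳ z z≢0)) (*-identityʳ w)))

  ⁻¹-unique : ∀ {x y} → x * y ≡ 1# → x ⁻¹ ≡ y
  ⁻¹-unique {x} {y} xy≡1 = *-cancelʳ x≢0 (begin
    x ⁻¹ * x   ≡⟨ *-comm (x ⁻¹) x ⟩
    x * x ⁻¹   ≡⟨ inverseʳ x x≢0 ⟩
    1#         ≡⟨ xy≡1 ⟨
    x * y      ≡⟨ *-comm x y ⟩
    y * x      ∎)
    where
    x≢0 : x ≢ 0#
    x≢0 x≡0 = 0≢1 (trans (sym (zeroˡ y)) (trans (cong (_* y) (sym x≡0)) xy≡1))

  ^-homo-* : ∀ x k l → x ^ (k ℕ.+ l) ≡ x ^ k * x ^ l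
  ^-homo-* x zero    l = sym (*-identityˡ (x ^ l))
  ^-homo-* x (suc k) l = trans (cong (x *_) (^-homo-* x k l)) (sym (*-assoc x (x ^ k) (x ^ l)))

  ^-distrib-* : ∀ x y k → (x * y) ^ k ≡ x ^ k * y ^ k
  ^-distrib-* x y zero    = sym (*-identityˡ 1#)
  ^-distrib-* x y (suc k) = trans (cong (x * y *_) (^-distrib-* x y k)) (interchange x y (x ^ k) (y ^ k))
    where open CommutativeSemigroupProperties *-commutativeSemigroup using (interchange)

  1^k≡1 : ∀ k → 1# ^ k ≡ 1#
  1^k≡1 zero    = refl
  1^k≡1 (suc k) = trans (*-identityˡ (1# ^ k)) (1^k≡1 k)

  ^-assocʳ : ∀ x k l → (x ^ k) ^ l ≡ x ^ (k ℕ.* l)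
  ^-assocʳ x zero    l = 1^k≡1 l
  ^-assocʳ x (suc k) l = begin
    (x * x ^ k) ^ l          ≡⟨ ^-distrib-* x (x ^ k) l ⟩
    x ^ l * (x ^ k) ^ l      ≡⟨ cong (x ^ l *_) (^-assocʳ x k l) ⟩
    x ^ l * x ^ (k ℕ.* l)    ≡⟨ ^-homo-* x l (k ℕ.* l) ⟨
    x ^ (l ℕ.+ k ℕ.* l)      ∎

  ^-nonzero : ∀ {x} → x ≢ 0# → ∀ k → x ^ k ≢ 0#
  ^-nonzero x≢0 zero    = 0≢1 ∘ sym
  ^-nonzero x≢0 (suc k) = *-nonzero x≢0 (^-nonzero x≢0 k)

-- Sums over all elements of a finite field.

module SumOver {m} (E : FiniteField m) (M : CommutativeMonoid 0ℓ 0ℓ) where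
  private
    module E = FiniteField E
    module M = CommutativeMonoid M
  open MonoidSum M using (sum; sum-cong-≋; sum-replicate-zero; sum-remove; sum-permute; ∑-distrib-+)
  open Inverse E.enum using (to; from; strictlyInverseˡ; strictlyInverseʳ)

  -- The monoid is a parameter because products over the field are needed too, in the proof of
  -- `x^m≡x`.
  ∑ : (E.Carrier → M.Carrier) → M.Carrier
  ∑ φ = sum (φ ∘ from)

  ∑-cong : ∀ {φ ψ} → (∀ x → φ x M.≈ ψ x) → ∑ φ M.≈ ∑ ψ
  ∑-cong φ≈ψ = sum-cong-≋ (φ≈ψ ∘ from)

  ∑-distrib-∙ : ∀ φ ψ → ∑ (λ x → φ x M.∙ ψ x) M.≈ ∑ φ M.∙ ∑ ψ
  ∑-distrib-∙ φ ψ = ∑-distrib-+ (φ ∘ from) (ψ ∘ from)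

  ∑-permute : ∀ φ (σ τ : E.Carrier → E.Carrier) → (∀ x → σ (τ x) ≡ x) → (∀ x → τ (σ x) ≡ x) →
              ∑ (φ ∘ σ) M.≈ ∑ φ
  ∑-permute φ σ τ στ τσ = M.sym (M.trans
    (sum-permute (φ ∘ from) (permutation (to ∘ σ ∘ from) (to ∘ τ ∘ from) (conj σ τ στ) (conj τ σ τσ)))
    (∑-cong (λ x → M.reflexive (cong φ (strictlyInverseʳ (σ x))))))
    where
    conj : ∀ α β → (∀ x → α (β x) ≡ x) → ∀ i → to (α (from (to (β (from i))))) ≡ i
    conj α β αβ i = trans (cong (to ∘ α) (strictlyInverseʳ (β (from i))))
      (trans (cong to (αβ (from i))) (strictlyInverseˡ i))

  ∑-single : ∀ φ a → (∀ x → x ≢ a → φ x M.≈ M.ε) → ∑ φ M.≈ φ a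
  ∑-single φ a φ≈ε = M.trans
    (sum-single (φ ∘ from) (to a) (λ j j≢ → φ≈ε (from j) (λ eq → j≢ (trans (sym (strictlyInverseˡ j)) (cong to eq)))))
    (M.reflexive (cong φ (strictlyInverseʳ a)))
    where
    sum-single : ∀ {k} (t : Fin k → M.Carrier) i → (∀ j → j ≢ i → t j M.≈ M.ε) → sum t M.≈ t i
    sum-single {suc k} t i t≈ε = M.trans (sum-remove {i = i} t)
      (M.trans (M.∙-congˡ (M.trans (sum-cong-≋ (λ j → t≈ε _ (Fin.punchInᵢ≢i i j))) (sum-replicate-zero k)))
        (M.identityʳ (t i)))

-- Characteristic and Frobenius identity of a finite field.

module FiniteFieldProperties {m} (E : FiniteField m) where
  open FiniteField E
  open FieldProperties field'
  open SumOver E +-commutativeMonoid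
  private
    module ∏ = SumOver E *-commutativeMonoid
    module ∏Fin = MonoidSum *-commutativeMonoid

  ∑-distribˡ-* : ∀ c φ → ∑ (λ x → c * φ x) ≡ c * ∑ φ
  ∑-distribˡ-* c φ = sym (SemiringSum.*-distribˡ-sum semiring c (φ ∘ Inverse.from enum))

  -- Translation by `1#` permutes the field, so adding `1#` to each of the m elements leaves their
  -- total unchanged.
  m×1≡0 : let open Mult semiring renaming (_×_ to _ℕ×_) in m ℕ× 1# ≡ 0#
  m×1≡0 = trans (sym (MonoidSum.sum-replicate +-commutativeMonoid m))
    (+-cancelˡ (∑ (λ x → x)) _ _ (begin
      ∑ (λ x → x) + ∑ (λ _ → 1#)   ≡⟨ ∑-distrib-∙ (λ x → x) (λ _ → 1#) ⟨
      ∑ (λ x → x + 1#)             ≡⟨ ∑-permute (λ x → x) (_+ 1#) (_- 1#) -+ +- ⟩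
      ∑ (λ x → x)                  ≡⟨ +-identityʳ _ ⟨
      ∑ (λ x → x) + 0#             ∎))
    where
    -+ : ∀ x → x - 1# + 1# ≡ x
    -+ x = trans (+-assoc x (- 1#) 1#) (trans (cong (x +_) (trans (+-comm (- 1#) 1#) (-‿inverseʳ 1#))) (+-identityʳ x))
    +- : ∀ x → x + 1# - 1# ≡ x
    +- x = trans (+-assoc x 1# (- 1#)) (trans (cong (x +_) (-‿inverseʳ 1#)) (+-identityʳ x))

  -- By `m×1≡0` the k-th power of `1# + 1#` vanishes, and a field has no nonzero nilpotent element.
  m≡2^k⇒1+1≡0 : ∀ k → m ≡ 2 ℕ.^ k → 1# + 1# ≡ 0#
  m≡2^k⇒1+1≡0 k m≡2^k = decidable-stable ((1# + 1#) ≟ 0#)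
    (λ 2≢0 → ^-nonzero 2≢0 k (trans (sym (2^k×1 k)) (trans (cong (_ℕ× 1#) (sym m≡2^k)) m×1≡0)))
    where
    open Mult semiring renaming (_×_ to _ℕ×_) using (×1-homo-*)
    2^k×1 : ∀ k → (2 ℕ.^ k) ℕ× 1# ≡ (1# + 1#) ^ k
    2^k×1 zero    = +-identityʳ 1#
    2^k×1 (suc k) = trans (×1-homo-* 2 (2 ℕ.^ k)) (cong₂ _*_ (cong (1# +_) (+-identityʳ 1#)) (2^k×1 k))

  -- Multiplication by x permutes the nonzero elements; s replaces the factor 0 by 1,
  -- so that the product over the whole field is nonzero.
  x^m≡x : ∀ x → x ^ m ≡ x
  x^m≡x x with x ≟ 0#
  ... | yes refl = zero^m m (Inverse.to enum 0#)
    where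
    zero^m : ∀ k → Fin k → 0# ^ k ≡ 0#
    zero^m (suc k) _ = zeroˡ (0# ^ k)
  ... | no x≢0 = *-cancelʳ ∏s≢0 (begin
    x ^ m * ∏.∑ s                    ≡⟨ cong (_* ∏.∑ s) (const-∏ m) ⟨
    ∏.∑ (λ _ → x) * ∏.∑ s            ≡⟨ ∏.∑-distrib-∙ (λ _ → x) s ⟨
    ∏.∑ (λ e → x * s e)              ≡⟨ ∏.∑-cong x*s ⟩
    ∏.∑ (λ e → δ e * s (x * e))      ≡⟨ ∏.∑-distrib-∙ δ (s ∘ (x *_)) ⟩
    ∏.∑ δ * ∏.∑ (s ∘ (x *_))         ≡⟨ cong₂ _*_ ∏δ (∏.∑-permute s (x *_) (x ⁻¹ *_) xx⁻¹ x⁻¹x) ⟩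
    x * ∏.∑ s                        ∎)
    where
    s δ : Carrier → Carrier
    s e with e ≟ 0#
    ... | yes _ = 1#
    ... | no _  = e
    -- At e = 0 the left side x * s e is x while s (x * e) is 1; `δ` records this leftover x, which
    -- is all that its product over the field retains.
    δ e with e ≟ 0#
    ... | yes _ = x
    ... | no _  = 1#

    s≢0 : ∀ e → s e ≢ 0#
    s≢0 e with e ≟ 0#
    ... | yes _  = 0≢1 ∘ sym
    ... | no e≢0 = e≢0

    ∏-nonzero : ∀ {k} (t : Fin k → Carrier) → (∀ i → t i ≢ 0#) → ∏Fin.sum t ≢ 0#
    ∏-nonzero {zero}  t t≢0 = 0≢1 ∘ sym
    ∏-nonzero {suc k} t t≢0 = *-nonzero (t≢0 zero) (∏-nonzero (t ∘ suc) (t≢0 ∘ suc))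

    ∏s≢0 : ∏.∑ s ≢ 0#
    ∏s≢0 = ∏-nonzero (s ∘ Inverse.from enum) (s≢0 ∘ Inverse.from enum)

    const-∏ : ∀ k → ∏Fin.sum {k} (λ _ → x) ≡ x ^ k
    const-∏ zero    = refl
    const-∏ (suc k) = cong (x *_) (const-∏ k)

    ∏δ : ∏.∑ δ ≡ x
    ∏δ = trans (∏.∑-single δ 0# δ≡1) δ0
      where
      δ≡1 : ∀ e → e ≢ 0# → δ e ≡ 1#
      δ≡1 e e≢0 with e ≟ 0#
      ... | yes e≡0 = contradiction e≡0 e≢0
      ... | no _    = refl
      δ0 : δ 0# ≡ x
      δ0 with 0# ≟ 0#
      ... | yes _  = refl
      ... | no 0≢0 = contradiction refl 0≢0

    x*s : ∀ e → x * s e ≡ δ e * s (x * e)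
    x*s e with e ≟ 0# | (x * e) ≟ 0#
    ... | yes _   | yes _    = refl
    ... | yes e≡0 | no xe≢0  = contradiction (trans (cong (x *_) e≡0) (zeroʳ x)) xe≢0
    ... | no e≢0  | yes xe≡0 = contradiction (x≢0∧xy≡0⇒y≡0 x≢0 xe≡0) e≢0
    ... | no _    | no _     = sym (*-identityˡ (x * e))

    xx⁻¹ : ∀ e → x * (x ⁻¹ * e) ≡ e
    xx⁻¹ e = trans (sym (*-assoc x (x ⁻¹) e)) (trans (cong (_* e) (inverseʳ x x≢0)) (*-identityˡ e))
    x⁻¹x : ∀ e → x ⁻¹ * (x * e) ≡ e
    x⁻¹x e = trans (sym (*-assoc (x ⁻¹) x e))
      (trans (cong (_* e) (trans (*-comm (x ⁻¹) x) (inverseʳ x x≢0))) (*-identityˡ e))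

-- Computation in characteristic two.

HasCharacteristicTwo : Field → Set
HasCharacteristicTwo K = 1# + 1# ≡ 0#
  where open Field K

module CharacteristicTwo (K : Field) (1+1≡0 : HasCharacteristicTwo K) where
  open Field K
  open FieldProperties K

  bit : Bool → Carrier
  bit b = if b then 1# else 0#

  bit-xor : ∀ b c → bit (b xor c) ≡ bit b + bit c
  bit-xor false c     = sym (+-identityˡ (bit c))
  bit-xor true  false = sym (+-identityʳ 1#)
  bit-xor true  true  = sym 1+1≡0

  private
    bit-∧ : ∀ b c → bit (b ∧ c) ≡ bit b * bit c
    bit-∧ false c = sym (zeroˡ (bit c))
    bit-∧ true  c = sym (*-identityˡ (bit c))

    bit-neg : ∀ b → bit b ≡ - bit b
    bit-neg b = +-cancelˡ (bit b) _ _
      (trans (sym (bit-xor b b)) (trans (cong bit (Bool.xor-same b)) (sym (-‿inverseʳ (bit b)))))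

    bit≟ : ∀ b c → Maybe (bit b ≡ bit c)
    bit≟ b c with b Bool.≟ c
    ... | yes b≡c = just (cong bit b≡c)
    ... | no _    = nothing

    bit-morphism : CommutativeRing.rawRing Bool.xor-∧-commutativeRing -Raw-AlmostCommutative⟶ fromCommutativeRing commutativeRing
    bit-morphism = record
      { ⟦_⟧ = bit ; +-homo = bit-xor ; *-homo = bit-∧ ; -‿homo = bit-neg ; 0-homo = refl ; 1-homo = refl }

  -- The coefficients are the two-element field `Bool` with `xor` and `∧`, so that normalisation
  -- itself cancels equal terms and ignores signs.
  module Solver = Algebra.Solver.Ring
    (CommutativeRing.rawRing Bool.xor-∧-commutativeRing) (fromCommutativeRing commutativeRing) bit-morphism bit≟

  open Solver using (Polynomial; solve; _:=_; _:+_; _:*_; :-_; con)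

  x+x≡0 : ∀ x → x + x ≡ 0#
  x+x≡0 = solve 1 (λ x → x :+ x := con false) refl

  -x≡x : ∀ x → - x ≡ x
  -x≡x = solve 1 (λ x → :- x := x) refl

  x+y≡0⇒x≡y : ∀ {x y} → x + y ≡ 0# → x ≡ y
  x+y≡0⇒x≡y {x} {y} x+y≡0 = begin
    x            ≡⟨ solve 2 (λ x y → x := (x :+ y) :+ y) refl x y ⟩
    x + y + y    ≡⟨ cong (_+ y) x+y≡0 ⟩
    0# + y       ≡⟨ +-identityˡ y ⟩
    y            ∎

  -- Squaring is additive because the cross term is doubled; this is iterated k times.
  ^2^-distrib-+ : ∀ k x y → (x + y) ^ (2 ℕ.^ k) ≡ x ^ (2 ℕ.^ k) + y ^ (2 ℕ.^ k)
  ^2^-distrib-+ zero    x y = distribʳ 1# x y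
  ^2^-distrib-+ (suc k) x y = begin
    (x + y) ^ (2 ℕ.* 2 ℕ.^ k)                        ≡⟨ ^-assocʳ (x + y) 2 (2 ℕ.^ k) ⟨
    ((x + y) ^ 2) ^ (2 ℕ.^ k)                        ≡⟨ cong (_^ (2 ℕ.^ k)) (square x y) ⟩
    (x ^ 2 + y ^ 2) ^ (2 ℕ.^ k)                      ≡⟨ ^2^-distrib-+ k (x ^ 2) (y ^ 2) ⟩
    (x ^ 2) ^ (2 ℕ.^ k) + (y ^ 2) ^ (2 ℕ.^ k)        ≡⟨ cong₂ _+_ (^-assocʳ x 2 (2 ℕ.^ k)) (^-assocʳ y 2 (2 ℕ.^ k)) ⟩
    x ^ (2 ℕ.* 2 ℕ.^ k) + y ^ (2 ℕ.* 2 ℕ.^ k)        ∎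
    where
    square : ∀ x y → (x + y) ^ 2 ≡ x ^ 2 + y ^ 2
    square = solve 2 (λ x y → (x :+ y) :* ((x :+ y) :* con true) := x :* (x :* con true) :+ y :* (y :* con true)) refl

  -- Roots of monic polynomials.

  evalMonic : ∀ {d} → Vec Carrier d → Carrier → Carrier
  evalMonic []       x = 1#
  evalMonic (c ∷ cs) x = c + x * evalMonic cs x

  -- Synthetic division by X + a, that is X - a. The leading coefficient `1#` is left out of the
  -- vectors, so the length is the degree and the quotient is again monic.
  divide : ∀ {d} (cs : Vec Carrier (suc d)) a →
           Σ (Vec Carrier d) λ ds → ∀ x → evalMonic cs x ≡ (x + a) * evalMonic ds x + evalMonic cs a
  divide (c ∷ [])      a = [] , solve 3 (λ c a x →
    c :+ x :* con true := (x :+ a) :* con true :+ (c :+ a :* con true)) refl c a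
  divide (c ∷ cs@(_ ∷ _)) a with divide cs a
  ... | ds , eq = evalMonic cs a ∷ ds , λ x → trans (cong (λ v → c + x * v) (eq x))
    (solve 5 (λ c x a d v → c :+ x :* ((x :+ a) :* d :+ v) := (x :+ a) :* (v :+ x :* d) :+ (c :+ a :* v))
      refl c x a (evalMonic ds x) (evalMonic cs a))

  -- Dividing by X + root zero leaves no remainder, and every other root, being different, is a root
  -- of the quotient. In degree 0 the polynomial is `1#`, which has no root.
  monic-roots : ∀ {d} (cs : Vec Carrier d) (root : Fin (suc d) → Carrier) → Injective _≡_ _≡_ root →
                ¬ (∀ i → evalMonic cs (root i) ≡ 0#)
  monic-roots []           root inj isRoot = 0≢1 (sym (isRoot zero))
  monic-roots cs@(_ ∷ _)   root inj isRoot with divide cs (root zero)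
  ... | ds , eq = monic-roots ds (root ∘ suc) (Fin.suc-injective ∘ inj) λ i →
    x≢0∧xy≡0⇒y≡0 (λ eq₀ → contradiction (inj (x+y≡0⇒x≡y eq₀)) λ ())
      (begin
        (root (suc i) + root zero) * evalMonic ds (root (suc i))                             ≡⟨ +-identityʳ _ ⟨
        (root (suc i) + root zero) * evalMonic ds (root (suc i)) + 0#                        ≡⟨ cong ((root (suc i) + root zero) * evalMonic ds (root (suc i)) +_) (isRoot zero) ⟨
        (root (suc i) + root zero) * evalMonic ds (root (suc i)) + evalMonic cs (root zero)  ≡⟨ eq (root (suc i)) ⟨
        evalMonic cs (root (suc i))                                                          ≡⟨ isRoot (suc i) ⟩
        0#                                                                                   ∎)

  -- Powers of A u + i + ε z modulo z² = z + u.

  eval : List Carrier → Carrier → Carrier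
  eval []       x = 0#
  eval (c ∷ cs) x = c + x * eval cs x

  -- The coefficient of z in (A u + i + z)¹¹ modulo z² = z + u is polyPart(u) + i polePart(i),
  -- where w stands for u i, which is 1 when i = 1/u.
  polyPart polePart : Carrier → Carrier → List Carrier
  polyPart A w = 1# + w * w ∷ 1# + w + A + A² * w ∷ w * w + A² ∷ 1# + w + A + A² + A² * A ∷ 1# + A² ∷ 1# + A ∷
    A² + A⁸ * (w * w) ∷ A⁸ * w ∷ A⁸ ∷ A⁸ + A⁸ * A ∷ A⁸ * A² ∷ []
    where
    A² = A * A
    A⁸ = A² * A² * (A² * A²)
  polePart A w = 1# + w + A * w ∷ 1# ∷ 1# ∷ 0# ∷ 0# ∷ A * A * (w * w) ∷ w + A * w ∷ 1# ∷ 1# ∷ 1# ∷ []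

  -- The z-free part of the same eleventh power. It stays unexpanded, since all that matters is that
  -- it is a function of u and i, hence invariant under X ↦ X + 1.
  invariantPart : Carrier → Carrier → Carrier → Carrier
  invariantPart A u i = a * (s * p + u) + u * (1# * (s + p + 1#))
    where
    s = A * u + i
    p = s * s + u
    a = (p * p + u) * (p * p + u) + u

  -- Here a + z is the eighth power and d + c z the cube of s + z. Writing u i for w makes this a
  -- polynomial identity in A, u and i over the two-element field, which the solver can check
  -- without the relation u i = 1.
  coefficient : ∀ A u i →
    let s = A * u + i
        p = s * s + u
        a = (p * p + u) * (p * p + u) + u
        c = s + p + 1#
        d = s * p + u
    in a * c + 1# * d + 1# * c ≡ eval (polyPart A (u * i)) u + i * eval (polePart A (u * i)) i
  coefficient = solve 3 (λ A u i →
    let s  = A :* u :+ i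
        p  = s :* s :+ u
        a  = (p :* p :+ u) :* (p :* p :+ u) :+ u
        c  = s :+ p :+ con true
        d  = s :* p :+ u
        w  = u :* i
        A² = A :* A
        A⁸ = A² :* A² :* (A² :* A²)
    in a :* c :+ con true :* d :+ con true :* c :=
      horner (con true :+ w :* w ∷ con true :+ w :+ A :+ A² :* w ∷ w :* w :+ A² ∷
        con true :+ w :+ A :+ A² :+ A² :* A ∷ con true :+ A² ∷ con true :+ A ∷
        A² :+ A⁸ :* (w :* w) ∷ A⁸ :* w ∷ A⁸ ∷ A⁸ :+ A⁸ :* A ∷ A⁸ :* A² ∷ []) u
      :+ i :* horner (con true :+ w :+ A :* w ∷ con true ∷ con true ∷ con false ∷ con false ∷
        A :* A :* (w :* w) ∷ w :+ A :* w ∷ con true ∷ con true ∷ con true ∷ []) i)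
    refl
    where
    horner : ∀ {k} → List (Polynomial k) → Polynomial k → Polynomial k
    horner []       x = con false
    horner (c ∷ cs) x = c :+ x :* horner cs x

  module _ {z u : Carrier} (z²≡z+u : z * z ≡ z + u) where

    -- Squaring keeps the coefficient of z equal to 1, so the second, fourth and eighth powers all
    -- have the shape s' + z.
    square-s+z : ∀ s → (s + z) * (s + z) ≡ (s * s + u) + z
    square-s+z s = begin
      (s + z) * (s + z)   ≡⟨ solve 2 (λ s z → (s :+ z) :* (s :+ z) := s :* s :+ z :* z) refl s z ⟩
      s * s + z * z       ≡⟨ cong (s * s +_) z²≡z+u ⟩
      s * s + (z + u)     ≡⟨ solve 3 (λ s z u → s :* s :+ (z :+ u) := (s :* s :+ u) :+ z) refl s z u ⟩
      (s * s + u) + z     ∎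

    [a+bz][c+dz] : ∀ a b c d → (a + b * z) * (c + d * z) ≡ z * (a * d + b * c + b * d) + (a * c + u * (b * d))
    [a+bz][c+dz] a b c d = begin
      (a + b * z) * (c + d * z)
        ≡⟨ solve 5 (λ a b c d z → (a :+ b :* z) :* (c :+ d :* z) :=
             a :* c :+ z :* (a :* d :+ b :* c) :+ b :* d :* (z :* z)) refl a b c d z ⟩
      a * c + z * (a * d + b * c) + b * d * (z * z)
        ≡⟨ cong (λ w → a * c + z * (a * d + b * c) + b * d * w) z²≡z+u ⟩
      a * c + z * (a * d + b * c) + b * d * (z + u)
        ≡⟨ solve 6 (λ a b c d z u → a :* c :+ z :* (a :* d :+ b :* c) :+ b :* d :* (z :+ u) :=
             z :* (a :* d :+ b :* c :+ b :* d) :+ (a :* c :+ u :* (b :* d))) refl a b c d z u ⟩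
      z * (a * d + b * c + b * d) + (a * c + u * (b * d))  ∎

    -- In the coefficient of z the element s enters only through s and s² = A² u² + i², so u and i
    -- do not get multiplied and the relation u i = 1 does not enter.
    cube : ∀ A ε i → let s = A * u + i in
      (s + ε * z) ^ 3 ≡
        z * (eval (ε * ε * ε ∷ ε * ε * A + ε * ε * ε ∷ ε * (A * A) ∷ []) u + i * eval (ε * ε ∷ ε ∷ []) i)
        + (s * (s * s + ε * ε * u) + u * (ε * (ε * ε)))
    cube A ε i = begin
      (s + ε * z) ^ 3
        ≡⟨ solve 3 (λ s ε z → let g = s :+ ε :* z in
             g :* (g :* (g :* con true)) := g :* (s :* s :+ ε :* ε :* (z :* z))) refl s ε z ⟩
      (s + ε * z) * (s * s + ε * ε * (z * z))
        ≡⟨ cong (λ w → (s + ε * z) * (s * s + ε * ε * w)) z²≡z+u ⟩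
      (s + ε * z) * (s * s + ε * ε * (z + u))
        ≡⟨ solve 4 (λ s ε z u → (s :+ ε :* z) :* (s :* s :+ ε :* ε :* (z :+ u)) :=
             (s :+ ε :* z) :* ((s :* s :+ ε :* ε :* u) :+ ε :* ε :* z)) refl s ε z u ⟩
      (s + ε * z) * ((s * s + ε * ε * u) + ε * ε * z)
        ≡⟨ [a+bz][c+dz] s ε (s * s + ε * ε * u) (ε * ε) ⟩
      z * (s * (ε * ε) + ε * (s * s + ε * ε * u) + ε * (ε * ε)) + h
        ≡⟨ cong (λ w → z * w + h) (solve 4 (λ A ε u i → let s = A :* u :+ i in
             s :* (ε :* ε) :+ ε :* (s :* s :+ ε :* ε :* u) :+ ε :* (ε :* ε) :=
             (ε :* ε :* ε :+ u :* (ε :* ε :* A :+ ε :* ε :* ε :+ u :* (ε :* (A :* A) :+ u :* con false)))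
             :+ i :* (ε :* ε :+ i :* (ε :+ i :* con false))) refl A ε u i) ⟩
      z * (eval (ε * ε * ε ∷ ε * ε * A + ε * ε * ε ∷ ε * (A * A) ∷ []) u + i * eval (ε * ε ∷ ε ∷ []) i) + h ∎
      where
      s = A * u + i
      h = s * (s * s + ε * ε * u) + u * (ε * (ε * ε))

    -- Since 11 = 8 + 3, three squarings give g⁸ = a + z, and g³ = g (p + z) = d + c z is a single
    -- product.
    eleventh-power : ∀ A i → u * i ≡ 1# →
      (A * u + i + z) ^ 11 ≡ z * (eval (polyPart A 1#) u + i * eval (polePart A 1#) i) + invariantPart A u i
    eleventh-power A i ui≡1 = begin
      g ^ 11
        ≡⟨ solve 1 (λ g → let g² = g :* g ; g⁴ = g² :* g² in
             g :* (g :* (g :* (g :* (g :* (g :* (g :* (g :* (g :* (g :* (g :* con true)))))))))) :=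
             g⁴ :* g⁴ :* (g :* g²)) refl g ⟩
      g * g * (g * g) * (g * g * (g * g)) * (g * (g * g))
        ≡⟨ cong (λ v → v * v * (v * v) * (g * v)) (square-s+z s) ⟩
      (p + z) * (p + z) * ((p + z) * (p + z)) * (g * (p + z))
        ≡⟨ cong (λ v → v * v * (g * (p + z))) (square-s+z p) ⟩
      (p * p + u + z) * (p * p + u + z) * (g * (p + z))
        ≡⟨ cong (_* (g * (p + z))) (square-s+z (p * p + u)) ⟩
      (a + z) * (g * (p + z))
        ≡⟨ cong (λ v → (a + z) * v) (trans
             (solve 3 (λ s z p → (s :+ z) :* (p :+ z) := (s :+ con true :* z) :* (p :+ con true :* z)) refl s z p)
             ([a+bz][c+dz] s 1# p 1#)) ⟩
      (a + z) * (z * (s * 1# + 1# * p + 1# * 1#) + (s * p + u * (1# * 1#)))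
        ≡⟨ solve 5 (λ a z s p u → (a :+ z) :* (z :* (s :* con true :+ con true :* p :+ con true :* con true)
               :+ (s :* p :+ u :* (con true :* con true))) :=
             (a :+ con true :* z) :* ((s :* p :+ u) :+ (s :+ p :+ con true) :* z)) refl a z s p u ⟩
      (a + 1# * z) * (d + c * z)
        ≡⟨ [a+bz][c+dz] a 1# d c ⟩
      z * (a * c + 1# * d + 1# * c) + (a * d + u * (1# * c))
        ≡⟨ cong (λ v → z * v + invariantPart A u i) (coefficient A u i) ⟩
      z * (eval (polyPart A (u * i)) u + i * eval (polePart A (u * i)) i) + invariantPart A u i
        ≡⟨ cong (λ w → z * (eval (polyPart A w) u + i * eval (polePart A w) i) + invariantPart A u i) ui≡1 ⟩
      z * (eval (polyPart A 1#) u + i * eval (polePart A 1#) i) + invariantPart A u i ∎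
      where
      s = A * u + i
      g = s + z
      p = s * s + u
      a = (p * p + u) * (p * p + u) + u
      c = s + p + 1#
      d = s * p + u

-- The subfield F of order q and sums over it.

module Subfield (n : ℕ) (5≤n : 5 ≤ n) (E : FiniteField ((2 ℕ.^ n) ℕ.^ 2)) where
  open FiniteField E
  open FieldProperties field'
  open FiniteFieldProperties E
  open SumOver E +-commutativeMonoid

  q : ℕ
  q = 2 ℕ.^ n

  32≤q : 32 ≤ q
  32≤q = ℕ.^-monoʳ-≤ 2 5≤n

  open CharacteristicTwo field' (m≡2^k⇒1+1≡0 (n ℕ.* 2) (ℕ.^-*-assoc 2 n 2))
  open Solver using (solve; _:=_; _:+_; _:*_; con)

  [x^q]^q≡x : ∀ x → (x ^ q) ^ q ≡ x
  [x^q]^q≡x x = begin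
    (x ^ q) ^ q     ≡⟨ ^-assocʳ x q q ⟩
    x ^ (q ℕ.* q)   ≡⟨ cong (λ k → x ^ (q ℕ.* k)) (ℕ.*-identityʳ q) ⟨
    x ^ (q ℕ.^ 2)   ≡⟨ x^m≡x x ⟩
    x               ∎

  InF : Carrier → Set
  InF = InSubfield E q

  ^q-distrib-+ : ∀ x y → (x + y) ^ q ≡ x ^ q + y ^ q
  ^q-distrib-+ = ^2^-distrib-+ n

  F-+ : ∀ {x y} → InF x → InF y → InF (x + y)
  F-+ {x} {y} x∈F y∈F = trans (^q-distrib-+ x y) (cong₂ _+_ x∈F y∈F)

  F-* : ∀ {x y} → InF x → InF y → InF (x * y)
  F-* {x} {y} x∈F y∈F = trans (^-distrib-* x y q) (cong₂ _*_ x∈F y∈F)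

  F-1 : InF 1#
  F-1 = 1^k≡1 q

  F-0 : InF 0#
  F-0 = subst InF (x+x≡0 1#) (F-+ F-1 F-1)

  F-⁻¹ : ∀ {x} → x ≢ 0# → InF x → InF (x ⁻¹)
  F-⁻¹ {x} x≢0 x∈F = sym (⁻¹-unique (begin
    x * (x ⁻¹) ^ q       ≡⟨ cong (_* (x ⁻¹) ^ q) x∈F ⟨
    x ^ q * (x ⁻¹) ^ q   ≡⟨ ^-distrib-* x (x ⁻¹) q ⟨
    (x * x ⁻¹) ^ q       ≡⟨ cong (_^ q) (inverseʳ x x≢0) ⟩
    1# ^ q               ≡⟨ F-1 ⟩
    1#                   ∎))

  -- Extension by zero makes a sum over F a sum over E, so that F need not be enumerated.
  restrict : (Carrier → Carrier) → Carrier → Carrier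
  restrict φ x with (x ^ q) ≟ x
  ... | yes _ = φ x
  ... | no _  = 0#

  Λ : (Carrier → Carrier) → Carrier
  Λ φ = ∑ (restrict φ)

  Λ-cong : ∀ {φ ψ} → (∀ x → InF x → φ x ≡ ψ x) → Λ φ ≡ Λ ψ
  Λ-cong {φ} {ψ} φ≡ψ = ∑-cong pointwise
    where
    pointwise : ∀ x → restrict φ x ≡ restrict ψ x
    pointwise x with (x ^ q) ≟ x
    ... | yes x∈F = φ≡ψ x x∈F
    ... | no _    = refl

  Λ-distrib-+ : ∀ φ ψ → Λ (λ x → φ x + ψ x) ≡ Λ φ + Λ ψ
  Λ-distrib-+ φ ψ = trans (∑-cong pointwise) (∑-distrib-∙ (restrict φ) (restrict ψ))
    where
    pointwise : ∀ x → restrict (λ x → φ x + ψ x) x ≡ restrict φ x + restrict ψ x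
    pointwise x with (x ^ q) ≟ x
    ... | yes _ = refl
    ... | no _  = sym (+-identityˡ 0#)

  Λ-distribˡ-* : ∀ c φ → Λ (λ x → c * φ x) ≡ c * Λ φ
  Λ-distribˡ-* c φ = trans (∑-cong pointwise) (∑-distribˡ-* c (restrict φ))
    where
    pointwise : ∀ x → restrict (λ x → c * φ x) x ≡ c * restrict φ x
    pointwise x with (x ^ q) ≟ x
    ... | yes _ = refl
    ... | no _  = sym (zeroʳ c)

  Λ-0 : Λ (λ _ → 0#) ≡ 0#
  Λ-0 = begin
    Λ (λ _ → 0#)         ≡⟨ Λ-cong (λ _ _ → sym (zeroˡ 0#)) ⟩
    Λ (λ _ → 0# * 0#)    ≡⟨ Λ-distribˡ-* 0# (λ _ → 0#) ⟩
    0# * Λ (λ _ → 0#)    ≡⟨ zeroˡ _ ⟩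
    0#                   ∎

  -- The maps are total on E, but they are constrained on F alone, where `Λ` looks at them.
  record PermutationOfF : Set where
    field
      fun inv : Carrier → Carrier
      fun∈F   : ∀ {x} → InF x → InF (fun x)
      inv∈F   : ∀ {x} → InF x → InF (inv x)
      fun-inv : ∀ {x} → InF x → fun (inv x) ≡ x
      inv-fun : ∀ {x} → InF x → inv (fun x) ≡ x

  -- A permutation of F extends by the identity to a permutation of E.
  Λ-permute : (π : PermutationOfF) → ∀ φ → Λ (φ ∘ PermutationOfF.fun π) ≡ Λ φ
  Λ-permute π φ = trans (∑-cong pointwise)
    (∑-permute (restrict φ) (extend fun) (extend inv) (inverse fun inv inv∈F fun-inv) (inverse inv fun fun∈F inv-fun))
    where
    open PermutationOfF π

    extend : (Carrier → Carrier) → Carrier → Carrier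
    extend σ x with (x ^ q) ≟ x
    ... | yes _ = σ x
    ... | no _  = x

    inverse : ∀ σ τ → (∀ {x} → InF x → InF (τ x)) → (∀ {x} → InF x → σ (τ x) ≡ x) →
              ∀ x → extend σ (extend τ x) ≡ x
    inverse σ τ τ∈F στ x with (x ^ q) ≟ x
    inverse σ τ τ∈F στ x | yes x∈F with (τ x ^ q) ≟ τ x
    ... | yes _   = στ x∈F
    ... | no τx∉F = contradiction (τ∈F x∈F) τx∉F
    inverse σ τ τ∈F στ x | no x∉F with (x ^ q) ≟ x
    ... | yes x∈F = contradiction x∈F x∉F
    ... | no _    = refl

    pointwise : ∀ x → restrict (φ ∘ fun) x ≡ restrict φ (extend fun x)
    pointwise x with (x ^ q) ≟ x
    pointwise x | yes x∈F with (fun x ^ q) ≟ fun x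
    ... | yes _    = refl
    ... | no fx∉F  = contradiction (fun∈F x∈F) fx∉F
    pointwise x | no x∉F with (x ^ q) ≟ x
    ... | yes x∈F = contradiction x∈F x∉F
    ... | no _    = refl

  -- Translations, scalings and power sums.

  translation : ∀ {c} → InF c → PermutationOfF
  translation {c} c∈F = record
    { fun = _+ c ; inv = _+ c
    ; fun∈F = λ x∈F → F-+ x∈F c∈F ; inv∈F = λ x∈F → F-+ x∈F c∈F
    ; fun-inv = λ {x} _ → twice x ; inv-fun = λ {x} _ → twice x }
    where
    twice : ∀ x → x + c + c ≡ x
    twice x = solve 2 (λ x c → x :+ c :+ c := x) refl x c

  scaling : ∀ {c} → c ≢ 0# → InF c → PermutationOfF
  scaling {c} c≢0 c∈F = record
    { fun = c *_ ; inv = c ⁻¹ *_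
    ; fun∈F = F-* c∈F ; inv∈F = F-* (F-⁻¹ c≢0 c∈F)
    ; fun-inv = λ {x} _ → trans (sym (*-assoc c (c ⁻¹) x)) (unit x)
    ; inv-fun = λ {x} _ → trans (sym (*-assoc (c ⁻¹) c x)) (trans (cong (_* x) (*-comm (c ⁻¹) c)) (unit x)) }
    where
    unit : ∀ x → c * c ⁻¹ * x ≡ x
    unit x = trans (cong (_* x) (inverseʳ c c≢0)) (*-identityˡ x)

  -- If the sum were nonzero, scaling invariance would give g ^ j = 1 for all g ∈ F*, in particular
  -- for all norms g = z ^ (q + 1), and X ^ (j (q + 1) + 1) - X would have too many roots.
  powerSum-suc : ∀ j → suc (suc j) < q → Λ (_^ suc j) ≡ 0#
  powerSum-suc j 2+j<q = decidable-stable (Λ (_^ suc j) ≟ 0#) λ Λ≢0 →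
    let
      g^≡1 : ∀ {g} → g ≢ 0# → InF g → g ^ suc j ≡ 1#
      g^≡1 {g} g≢0 g∈F = *-cancelʳ Λ≢0 (begin
        g ^ suc j * Λ (_^ suc j)            ≡⟨ Λ-distribˡ-* (g ^ suc j) (_^ suc j) ⟨
        Λ (λ x → g ^ suc j * x ^ suc j)     ≡⟨ Λ-cong (λ x _ → sym (^-distrib-* g x (suc j))) ⟩
        Λ (λ x → (g * x) ^ suc j)           ≡⟨ Λ-permute (scaling g≢0 g∈F) (_^ suc j) ⟩
        Λ (_^ suc j)                        ≡⟨ *-identityˡ _ ⟨
        1# * Λ (_^ suc j)                   ∎)

      isRoot : ∀ z → evalMonic (0# ∷ 1# ∷ replicate k 0#) z ≡ 0#
      isRoot z = trans (cong (λ v → 0# + z * (1# + z * v)) (evalMonic-X^ k z)) (root z (z ≟ 0#) g^≡1)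
    in monic-roots (0# ∷ 1# ∷ replicate k 0#) (λ i → Inverse.from enum (inject≤ i bound))
         (λ {i} {i'} eq → Fin.inject≤-injective bound bound i i'
           (trans (sym (Inverse.strictlyInverseˡ enum _)) (trans (cong (Inverse.to enum) eq) (Inverse.strictlyInverseˡ enum _))))
         (λ i → isRoot _)
    where
    -- With this k, `suc k` reduces to `suc q * suc j`; the polynomial has degree k + 2, and k + 3
    -- elements of E are enough for a contradiction.
    k = j ℕ.+ q ℕ.* suc j

    bound : suc (suc (suc k)) ≤ q ℕ.^ 2
    bound = ℕ.≤-trans (ℕ.+-monoˡ-≤ (q ℕ.* suc j) 2+j<q)
      (ℕ.≤-trans (ℕ.≤-reflexive (sym (ℕ.*-suc q (suc j))))
        (ℕ.≤-trans (ℕ.*-monoʳ-≤ q (ℕ.<⇒≤ 2+j<q)) (ℕ.≤-reflexive (cong (q ℕ.*_) (sym (ℕ.*-identityʳ q))))))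

    evalMonic-X^ : ∀ k x → evalMonic (replicate k 0#) x ≡ x ^ k
    evalMonic-X^ zero    x = refl
    evalMonic-X^ (suc k) x = trans (+-identityˡ _) (cong (x *_) (evalMonic-X^ k x))

    norm∈F : ∀ z → InF (z ^ suc q)
    norm∈F z = begin
      (z * z ^ q) ^ q        ≡⟨ ^-distrib-* z (z ^ q) q ⟩
      z ^ q * (z ^ q) ^ q    ≡⟨ cong (z ^ q *_) ([x^q]^q≡x z) ⟩
      z ^ q * z              ≡⟨ *-comm (z ^ q) z ⟩
      z * z ^ q              ∎

    root : ∀ z → Dec (z ≡ 0#) → (∀ {g} → g ≢ 0# → InF g → g ^ suc j ≡ 1#) → 0# + z * (1# + z * z ^ k) ≡ 0#
    root z (yes z≡0) _ = trans (+-identityˡ _) (trans (cong (_* (1# + z * z ^ k)) z≡0) (zeroˡ _))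
    root z (no z≢0) g^≡1 = begin
      0# + z * (1# + z ^ suc k)              ≡⟨ cong (λ v → 0# + z * (1# + v)) (^-assocʳ z (suc q) (suc j)) ⟨
      0# + z * (1# + (z ^ suc q) ^ suc j)    ≡⟨ cong (λ v → 0# + z * (1# + v)) (g^≡1 (^-nonzero z≢0 (suc q)) (norm∈F z)) ⟩
      0# + z * (1# + 1#)                     ≡⟨ solve 1 (λ z → con false :+ z :* (con true :+ con true) := con false) refl z ⟩
      0#                                     ∎

  -- Translation by `1#` preserves the sum of x * φ x, yet by invariance it adds `Λ φ` to it. This
  -- avoids choosing representatives of the pairs x, x + 1.
  Λ-invariant : ∀ φ → (∀ x → InF x → φ (x + 1#) ≡ φ x) → Λ φ ≡ 0#
  Λ-invariant φ φ-inv = +-cancelˡ (Λ (λ x → x * φ x)) _ _ (begin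
    Λ (λ x → x * φ x) + Λ φ            ≡⟨ Λ-distrib-+ (λ x → x * φ x) φ ⟨
    Λ (λ x → x * φ x + φ x)            ≡⟨ Λ-cong (λ x x∈F → shift x x∈F) ⟩
    Λ (λ x → (x + 1#) * φ (x + 1#))    ≡⟨ Λ-permute (translation F-1) (λ x → x * φ x) ⟩
    Λ (λ x → x * φ x)                  ≡⟨ +-identityʳ _ ⟨
    Λ (λ x → x * φ x) + 0#             ∎)
    where
    shift : ∀ x → InF x → x * φ x + φ x ≡ (x + 1#) * φ (x + 1#)
    shift x x∈F = trans (solve 2 (λ x p → x :* p :+ p := (x :+ con true) :* p) refl x (φ x))
      (cong ((x + 1#) *_) (sym (φ-inv x x∈F)))

  powerSum : ∀ j → suc j < q → Λ (_^ j) ≡ 0#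
  powerSum zero    _      = Λ-invariant (λ _ → 1#) (λ _ _ → refl)
  powerSum (suc j) 2+j<q  = powerSum-suc j 2+j<q

  -- On F the power q - 1 differs from the constant `1#` only at 0, and the constant sums to 0.
  powerSum-q-1 : ∀ j → suc j ≡ q → Λ (_^ j) ≡ 1#
  powerSum-q-1 zero    1≡q = contradiction (subst (32 ≤_) (sym 1≡q) 32≤q) λ { (s≤s ()) }
  powerSum-q-1 (suc j) 2+j≡q = begin
    Λ (_^ suc j)                 ≡⟨ ∑-cong pointwise ⟩
    ∑ (λ x → restrict (λ _ → 1#) x + δ x)   ≡⟨ ∑-distrib-∙ (restrict (λ _ → 1#)) δ ⟩
    Λ (λ _ → 1#) + ∑ δ           ≡⟨ cong₂ _+_ (powerSum 0 (ℕ.≤-trans (s≤s (s≤s z≤n)) 32≤q)) (trans (∑-single δ 0# δ≡0) δ0) ⟩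
    0# + 1#                      ≡⟨ +-identityˡ 1# ⟩
    1#                           ∎
    where
    δ : Carrier → Carrier
    δ x with x ≟ 0#
    ... | yes _ = 1#
    ... | no _  = 0#
    δ≡0 : ∀ x → x ≢ 0# → δ x ≡ 0#
    δ≡0 x x≢0 with x ≟ 0#
    ... | yes x≡0 = contradiction x≡0 x≢0
    ... | no _    = refl
    δ0 : δ 0# ≡ 1#
    δ0 with 0# ≟ 0#
    ... | yes _  = refl
    ... | no 0≢0 = contradiction refl 0≢0
    pointwise : ∀ x → restrict (_^ suc j) x ≡ restrict (λ _ → 1#) x + δ x
    pointwise x with (x ^ q) ≟ x | x ≟ 0#
    ... | yes x∈F | yes x≡0 = trans (cong (_* x ^ j) x≡0) (trans (zeroˡ _) (sym (x+x≡0 1#)))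
    ... | yes x∈F | no x≢0  = trans (*-cancelʳ x≢0 (begin
      x ^ suc j * x      ≡⟨ *-comm _ x ⟩
      x ^ suc (suc j)    ≡⟨ cong (x ^_) 2+j≡q ⟩
      x ^ q              ≡⟨ x∈F ⟩
      x                  ≡⟨ *-identityˡ x ⟨
      1# * x             ∎)) (sym (+-identityʳ 1#))
    ... | no x∉F  | yes x≡0 = contradiction (subst InF (sym x≡0) F-0) x∉F
    ... | no _    | no _    = sym (+-identityˡ 0#)

  -- Degree bounds for functions on F.

  -- The semantic consequence of "φ is a polynomial of degree at most d" that is needed here.
  Deg≤ : ℕ → (Carrier → Carrier) → Set
  Deg≤ d φ = ∀ a → suc (a ℕ.+ d) < q → Λ (λ x → x ^ a * φ x) ≡ 0#

  -- Likewise for "φ is a monic polynomial of degree d".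
  Monic : ℕ → (Carrier → Carrier) → Set
  Monic d φ = ∀ a → suc (a ℕ.+ d) ≡ q → Λ (λ x → x ^ a * φ x) ≡ 1#

  Deg≤⇒Λ≡0 : ∀ {d φ} → Deg≤ d φ → suc d < q → Λ φ ≡ 0#
  Deg≤⇒Λ≡0 {φ = φ} φ≤d d<q = trans (Λ-cong (λ x _ → sym (*-identityˡ (φ x)))) (φ≤d 0 d<q)

  Monic⇒Λ≡1 : ∀ {d φ} → Monic d φ → suc d ≡ q → Λ φ ≡ 1#
  Monic⇒Λ≡1 {φ = φ} φ-monic d≡q = trans (Λ-cong (λ x _ → sym (*-identityˡ (φ x)))) (φ-monic 0 d≡q)

  Deg≤-const : ∀ {d} c → Deg≤ d (λ _ → c)
  Deg≤-const {d} c a a<q = begin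
    Λ (λ x → x ^ a * c)   ≡⟨ Λ-cong (λ x _ → *-comm (x ^ a) c) ⟩
    Λ (λ x → c * x ^ a)   ≡⟨ Λ-distribˡ-* c (_^ a) ⟩
    c * Λ (_^ a)          ≡⟨ cong (c *_) (powerSum a (ℕ.≤-trans (s≤s (s≤s (ℕ.m≤m+n a d))) a<q)) ⟩
    c * 0#                ≡⟨ zeroʳ c ⟩
    0#                    ∎

  Deg≤-+ : ∀ {d φ ψ} → Deg≤ d φ → Deg≤ d ψ → Deg≤ d (λ x → φ x + ψ x)
  Deg≤-+ {φ = φ} {ψ} φ≤d ψ≤d a a<q = begin
    Λ (λ x → x ^ a * (φ x + ψ x))                  ≡⟨ Λ-cong (λ x _ → distribˡ (x ^ a) (φ x) (ψ x)) ⟩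
    Λ (λ x → x ^ a * φ x + x ^ a * ψ x)            ≡⟨ Λ-distrib-+ (λ x → x ^ a * φ x) (λ x → x ^ a * ψ x) ⟩
    Λ (λ x → x ^ a * φ x) + Λ (λ x → x ^ a * ψ x)  ≡⟨ cong₂ _+_ (φ≤d a a<q) (ψ≤d a a<q) ⟩
    0# + 0#                                        ≡⟨ +-identityˡ 0# ⟩
    0#                                             ∎

  -- The factor x ^ a in `Deg≤` and `Monic` is there for this step: a linear factor is absorbed by
  -- raising a, and the remaining term has lower degree.
  Λ-linear-factor : ∀ c (φ : Carrier → Carrier) a → Λ (λ x → x ^ a * ((x + c) * φ x)) ≡ Λ (λ x → x ^ suc a * φ x) + c * Λ (λ x → x ^ a * φ x)
  Λ-linear-factor c φ a = begin
    Λ (λ x → x ^ a * ((x + c) * φ x))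
      ≡⟨ Λ-cong (λ x _ → solve 4 (λ x y c p → y :* ((x :+ c) :* p) := x :* y :* p :+ c :* (y :* p)) refl x (x ^ a) c (φ x)) ⟩
    Λ (λ x → x ^ suc a * φ x + c * (x ^ a * φ x))
      ≡⟨ Λ-distrib-+ (λ x → x ^ suc a * φ x) (λ x → c * (x ^ a * φ x)) ⟩
    Λ (λ x → x ^ suc a * φ x) + Λ (λ x → c * (x ^ a * φ x))
      ≡⟨ cong (Λ (λ x → x ^ suc a * φ x) +_) (Λ-distribˡ-* c (λ x → x ^ a * φ x)) ⟩
    Λ (λ x → x ^ suc a * φ x) + c * Λ (λ x → x ^ a * φ x) ∎

  Deg≤-linear : ∀ {d φ} c → Deg≤ d φ → Deg≤ (suc d) (λ x → (x + c) * φ x)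
  Deg≤-linear {d} {φ} c φ≤d a a<q = begin
    Λ (λ x → x ^ a * ((x + c) * φ x))                        ≡⟨ Λ-linear-factor c φ a ⟩
    Λ (λ x → x ^ suc a * φ x) + c * Λ (λ x → x ^ a * φ x)    ≡⟨ cong₂ (λ v w → v + c * w) (φ≤d (suc a) sa<q) (φ≤d a (ℕ.<⇒≤ sa<q)) ⟩
    0# + c * 0#                                              ≡⟨ trans (+-identityˡ _) (zeroʳ c) ⟩
    0#                                                       ∎
    where
    sa<q : suc (suc a ℕ.+ d) < q
    sa<q = subst (λ k → suc k < q) (ℕ.+-suc a d) a<q

  Monic-linear : ∀ {d φ} c → Deg≤ d φ → Monic d φ → Monic (suc d) (λ x → (x + c) * φ x)
  Monic-linear {d} {φ} c φ≤d φ-monic a a≡q = begin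
    Λ (λ x → x ^ a * ((x + c) * φ x))                        ≡⟨ Λ-linear-factor c φ a ⟩
    Λ (λ x → x ^ suc a * φ x) + c * Λ (λ x → x ^ a * φ x)    ≡⟨ cong₂ (λ v w → v + c * w) (φ-monic (suc a) sa≡q) (φ≤d a (ℕ.≤-reflexive sa≡q)) ⟩
    1# + c * 0#                                              ≡⟨ trans (cong (1# +_) (zeroʳ c)) (+-identityʳ 1#) ⟩
    1#                                                       ∎
    where
    sa≡q : suc (suc a ℕ.+ d) ≡ q
    sa≡q = trans (cong suc (sym (ℕ.+-suc a d))) a≡q

  Deg≤-power : ∀ c k → Deg≤ k (λ x → (x + c) ^ k)
  Deg≤-power c zero    = Deg≤-const 1#
  Deg≤-power c (suc k) = Deg≤-linear c (Deg≤-power c k)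

  Monic-power : ∀ c k → Monic k (λ x → (x + c) ^ k)
  Monic-power c zero    a a≡q = trans (Λ-cong (λ x _ → *-identityʳ (x ^ a)))
    (powerSum-q-1 a (trans (cong suc (sym (ℕ.+-identityʳ a))) a≡q))
  Monic-power c (suc k) = Monic-linear c (Deg≤-power c k) (Monic-power c k)

  -- The sum over F of 1 / (z^a (z + 1)^b), by z (z + 1) = 1 / (1/z + 1/(z + 1)).
  pascal : ℕ → ℕ → Bool
  pascal zero    zero    = false
  pascal zero    (suc b) = true
  pascal (suc a) zero    = true
  pascal (suc a) (suc b) = pascal a (suc b) xor pascal (suc a) b

  -- Sums with poles at ρ and ρ + 1.

  module Poles (ρ : Carrier) (ρ^q≡ρ+1 : ρ ^ q ≡ ρ + 1#) where

    -- On F, `y₁` and `y₂` are 1/z and 1/(z + 1). Their sum `i`, the form in which they enter f,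
    -- equals their product and hence 1/u.
    z u y₁ y₂ i : Carrier → Carrier
    z x  = x + ρ
    u x  = z x * z x + z x
    y₁ x = (x + ρ) ⁻¹
    y₂ x = (x + (ρ + 1#)) ⁻¹
    i x  = y₁ x + y₂ x

    z^q≡z+1 : ∀ {x} → InF x → z x ^ q ≡ x + (ρ + 1#)
    z^q≡z+1 {x} x∈F = trans (^q-distrib-+ x ρ) (cong₂ _+_ x∈F ρ^q≡ρ+1)

    -- A zero of z would give 0 = z^q = z + 1 = 1.
    z≢0 : ∀ {x} → InF x → z x ≢ 0#
    z≢0 {x} x∈F z≡0 = 0≢1 (begin
      0#                  ≡⟨ F-0 ⟨
      0# ^ q              ≡⟨ cong (_^ q) z≡0 ⟨
      z x ^ q             ≡⟨ z^q≡z+1 x∈F ⟩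
      x + (ρ + 1#)        ≡⟨ +-assoc x ρ 1# ⟨
      z x + 1#            ≡⟨ cong (_+ 1#) z≡0 ⟩
      0# + 1#             ≡⟨ +-identityˡ 1# ⟩
      1#                  ∎)

    z*y₁≡1 : ∀ {x} → InF x → z x * y₁ x ≡ 1#
    z*y₁≡1 x∈F = inverseʳ _ (z≢0 x∈F)

    [z+1]*y₂≡1 : ∀ {x} → InF x → (x + (ρ + 1#)) * y₂ x ≡ 1#
    [z+1]*y₂≡1 x∈F = inverseʳ _ (subst (_≢ 0#) (z^q≡z+1 x∈F) (^-nonzero (z≢0 x∈F) q))

    y₁y₂≡i : ∀ {x} → InF x → y₁ x * y₂ x ≡ i x
    y₁y₂≡i {x} x∈F = begin
      y₁ x * y₂ x
        ≡⟨ solve 4 (λ x ρ y₁ y₂ → y₁ :* y₂ := y₁ :* ((x :+ (ρ :+ con true)) :* y₂) :+ (x :+ ρ) :* y₁ :* y₂) refl x ρ (y₁ x) (y₂ x) ⟩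
      y₁ x * ((x + (ρ + 1#)) * y₂ x) + z x * y₁ x * y₂ x
        ≡⟨ cong₂ (λ v w → y₁ x * v + w * y₂ x) ([z+1]*y₂≡1 x∈F) (z*y₁≡1 x∈F) ⟩
      y₁ x * 1# + 1# * y₂ x
        ≡⟨ cong₂ _+_ (*-identityʳ (y₁ x)) (*-identityˡ (y₂ x)) ⟩
      i x ∎

    u*i≡1 : ∀ {x} → InF x → u x * i x ≡ 1#
    u*i≡1 {x} x∈F = begin
      u x * i x                                 ≡⟨ cong (u x *_) (y₁y₂≡i x∈F) ⟨
      u x * (y₁ x * y₂ x)
        ≡⟨ solve 4 (λ x ρ y₁ y₂ → ((x :+ ρ) :* (x :+ ρ) :+ (x :+ ρ)) :* (y₁ :* y₂) := (x :+ ρ) :* y₁ :* ((x :+ (ρ :+ con true)) :* y₂)) refl x ρ (y₁ x) (y₂ x) ⟩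
      z x * y₁ x * ((x + (ρ + 1#)) * y₂ x)      ≡⟨ cong₂ _*_ (z*y₁≡1 x∈F) ([z+1]*y₂≡1 x∈F) ⟩
      1# * 1#                                   ≡⟨ *-identityˡ 1# ⟩
      1#                                        ∎

    y₁-shift : ∀ x → y₁ (x + 1#) ≡ y₂ x
    y₁-shift x = cong _⁻¹ (solve 2 (λ x ρ → x :+ con true :+ ρ := x :+ (ρ :+ con true)) refl x ρ)

    y₂-shift : ∀ x → y₂ (x + 1#) ≡ y₁ x
    y₂-shift x = cong _⁻¹ (solve 2 (λ x ρ → x :+ con true :+ (ρ :+ con true) := x :+ ρ) refl x ρ)

    i-shift : ∀ x → i (x + 1#) ≡ i x
    i-shift x = trans (cong₂ _+_ (y₁-shift x) (y₂-shift x)) (+-comm (y₂ x) (y₁ x))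

    u-shift : ∀ x → u (x + 1#) ≡ u x
    u-shift x = solve 2 (λ x ρ → let z = x :+ ρ ; z' = x :+ con true :+ ρ in z' :* z' :+ z' := z :* z :+ z) refl x ρ

    -- Each power of 1/z is the preceding one plus a power of z. That power of z has exponent q - 1
    -- and sum 1 in the case k = 0, and a smaller exponent and sum 0 otherwise.
    Λ-y₁^ : ∀ k → suc k ≤ q → Λ (λ x → y₁ x ^ suc k) ≡ 1#
    Λ-y₁^ k 1+k≤q = begin
      Λ (λ x → y₁ x ^ suc k)                      ≡⟨ Λ-cong pointwise ⟩
      Λ (λ x → z x ^ (q ℕ.∸ suc k) + y₁ x ^ k)    ≡⟨ Λ-distrib-+ (λ x → z x ^ (q ℕ.∸ suc k)) (λ x → y₁ x ^ k) ⟩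
      Λ (λ x → z x ^ (q ℕ.∸ suc k)) + Λ (λ x → y₁ x ^ k)   ≡⟨ step k 1+k≤q ⟩
      1#                                          ∎
      where
      split : q ≡ suc k ℕ.+ (q ℕ.∸ suc k)
      split = sym (ℕ.m+[n∸m]≡n 1+k≤q)

      -- Multiply by z ^ q + z = 1.
      pointwise : ∀ x → InF x → y₁ x ^ suc k ≡ z x ^ (q ℕ.∸ suc k) + y₁ x ^ k
      pointwise x x∈F = begin
        y * y ^ k
          ≡⟨ solve 3 (λ x ρ w → w := w :* (x :+ (ρ :+ con true)) :+ w :* (x :+ ρ)) refl x ρ (y * y ^ k) ⟩
        y * y ^ k * (x + (ρ + 1#)) + y * y ^ k * z x
          ≡⟨ cong₂ _+_ (cong (y ^ suc k *_) (sym (z^q≡z+1 x∈F)))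
               (solve 3 (λ y w z → y :* w :* z := z :* y :* w) refl y (y ^ k) (z x)) ⟩
        y ^ suc k * z x ^ q + z x * y * y ^ k
          ≡⟨ cong₂ _+_ (begin
               y ^ suc k * z x ^ q                                   ≡⟨ cong (λ l → y ^ suc k * z x ^ l) split ⟩
               y ^ suc k * z x ^ (suc k ℕ.+ (q ℕ.∸ suc k))           ≡⟨ cong (y ^ suc k *_) (^-homo-* (z x) (suc k) (q ℕ.∸ suc k)) ⟩
               y ^ suc k * (z x ^ suc k * z x ^ (q ℕ.∸ suc k))       ≡⟨ *-assoc _ _ _ ⟨
               y ^ suc k * z x ^ suc k * z x ^ (q ℕ.∸ suc k)         ≡⟨ cong (_* z x ^ (q ℕ.∸ suc k)) (^-distrib-* y (z x) (suc k)) ⟨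
               (y * z x) ^ suc k * z x ^ (q ℕ.∸ suc k)               ≡⟨ cong (λ v → v ^ suc k * z x ^ (q ℕ.∸ suc k)) (trans (*-comm y (z x)) (z*y₁≡1 x∈F)) ⟩
               1# ^ suc k * z x ^ (q ℕ.∸ suc k)                      ≡⟨ cong (_* z x ^ (q ℕ.∸ suc k)) (1^k≡1 (suc k)) ⟩
               1# * z x ^ (q ℕ.∸ suc k)                              ≡⟨ *-identityˡ _ ⟩
               z x ^ (q ℕ.∸ suc k)                                   ∎)
             (trans (cong (_* y ^ k) (z*y₁≡1 x∈F)) (*-identityˡ _)) ⟩
        z x ^ (q ℕ.∸ suc k) + y ^ k ∎
        where y = y₁ x

      step : ∀ k → suc k ≤ q → Λ (λ x → z x ^ (q ℕ.∸ suc k)) + Λ (λ x → y₁ x ^ k) ≡ 1#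
      step zero    1≤q = trans (cong₂ _+_ (Monic⇒Λ≡1 (Monic-power ρ (q ℕ.∸ 1)) (ℕ.m+[n∸m]≡n 1≤q))
          (Λ-invariant (λ _ → 1#) (λ _ _ → refl))) (+-identityʳ 1#)
      step (suc k) 2+k≤q = trans (cong₂ _+_ (Deg≤⇒Λ≡0 (Deg≤-power ρ (q ℕ.∸ suc (suc k))) small)
          (Λ-y₁^ k (ℕ.<⇒≤ 2+k≤q))) (+-identityˡ 1#)
        where
        small : suc (q ℕ.∸ suc (suc k)) < q
        small = ℕ.≤-trans (s≤s (s≤s (ℕ.∸-monoʳ-≤ q (s≤s (s≤s z≤n))))) (ℕ.≤-reflexive (ℕ.m+[n∸m]≡n {2} (ℕ.≤-trans (s≤s (s≤s z≤n)) 32≤q)))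

    -- Replacing a product `y₁ y₂` by `y₁ + y₂` lowers one exponent at a time. When a single pole is
    -- left the sum is 1, `y₂` being a translate of `y₁`.
    Λ-y₁^y₂^ : ∀ a b → a ≤ q → b ≤ q → Λ (λ x → y₁ x ^ a * y₂ x ^ b) ≡ bit (pascal a b)
    Λ-y₁^y₂^ zero    zero    _ _ = Λ-invariant _ (λ _ _ → refl)
    Λ-y₁^y₂^ zero    (suc b) _ b<q = begin
      Λ (λ x → 1# * y₂ x ^ suc b)       ≡⟨ Λ-cong (λ x _ → trans (*-identityˡ _) (cong (_^ suc b) (sym (y₁-shift x)))) ⟩
      Λ (λ x → y₁ (x + 1#) ^ suc b)     ≡⟨ Λ-permute (translation F-1) (λ x → y₁ x ^ suc b) ⟩
      Λ (λ x → y₁ x ^ suc b)            ≡⟨ Λ-y₁^ b b<q ⟩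
      1#                                ∎
    Λ-y₁^y₂^ (suc a) zero    a<q _ = trans (Λ-cong (λ x _ → *-identityʳ _)) (Λ-y₁^ a a<q)
    Λ-y₁^y₂^ (suc a) (suc b) a<q b<q = begin
      Λ (λ x → y₁ x ^ suc a * y₂ x ^ suc b)
        ≡⟨ Λ-cong pointwise ⟩
      Λ (λ x → y₁ x ^ a * y₂ x ^ suc b + y₁ x ^ suc a * y₂ x ^ b)
        ≡⟨ Λ-distrib-+ (λ x → y₁ x ^ a * y₂ x ^ suc b) (λ x → y₁ x ^ suc a * y₂ x ^ b) ⟩
      Λ (λ x → y₁ x ^ a * y₂ x ^ suc b) + Λ (λ x → y₁ x ^ suc a * y₂ x ^ b)
        ≡⟨ cong₂ _+_ (Λ-y₁^y₂^ a (suc b) (ℕ.<⇒≤ a<q) b<q) (Λ-y₁^y₂^ (suc a) b a<q (ℕ.<⇒≤ b<q)) ⟩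
      bit (pascal a (suc b)) + bit (pascal (suc a) b)
        ≡⟨ bit-xor (pascal a (suc b)) (pascal (suc a) b) ⟨
      bit (pascal (suc a) (suc b)) ∎
      where
      pointwise : ∀ x → InF x → y₁ x ^ suc a * y₂ x ^ suc b ≡ y₁ x ^ a * y₂ x ^ suc b + y₁ x ^ suc a * y₂ x ^ b
      pointwise x x∈F = begin
        y₁ x ^ suc a * y₂ x ^ suc b
          ≡⟨ solve 4 (λ y y' v w → y :* v :* (y' :* w) := y :* y' :* (v :* w)) refl (y₁ x) (y₂ x) (y₁ x ^ a) (y₂ x ^ b) ⟩
        y₁ x * y₂ x * (y₁ x ^ a * y₂ x ^ b)
          ≡⟨ cong (_* (y₁ x ^ a * y₂ x ^ b)) (y₁y₂≡i x∈F) ⟩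
        (y₁ x + y₂ x) * (y₁ x ^ a * y₂ x ^ b)
          ≡⟨ solve 4 (λ y y' v w → (y :+ y') :* (v :* w) := v :* (y' :* w) :+ y :* v :* w) refl (y₁ x) (y₂ x) (y₁ x ^ a) (y₂ x ^ b) ⟩
        y₁ x ^ a * y₂ x ^ suc b + y₁ x ^ suc a * y₂ x ^ b ∎

    -- The factor z cancels one `y₁` in (y₁ y₂)^(k + 1).
    Λ-zi^ : ∀ k → suc k ≤ q → Λ (λ x → z x * i x ^ suc k) ≡ bit (pascal k (suc k))
    Λ-zi^ k k<q = trans (Λ-cong pointwise) (Λ-y₁^y₂^ k (suc k) (ℕ.<⇒≤ k<q) k<q)
      where
      pointwise : ∀ x → InF x → z x * i x ^ suc k ≡ y₁ x ^ k * y₂ x ^ suc k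
      pointwise x x∈F = begin
        z x * i x ^ suc k                        ≡⟨ cong (λ v → z x * v ^ suc k) (y₁y₂≡i x∈F) ⟨
        z x * (y₁ x * y₂ x) ^ suc k              ≡⟨ cong (z x *_) (^-distrib-* (y₁ x) (y₂ x) (suc k)) ⟩
        z x * (y₁ x * y₁ x ^ k * y₂ x ^ suc k)   ≡⟨ solve 4 (λ z y v w → z :* (y :* v :* w) := z :* y :* (v :* w)) refl (z x) (y₁ x) (y₁ x ^ k) (y₂ x ^ suc k) ⟩
        z x * y₁ x * (y₁ x ^ k * y₂ x ^ suc k)   ≡⟨ cong (_* (y₁ x ^ k * y₂ x ^ suc k)) (z*y₁≡1 x∈F) ⟩
        1# * (y₁ x ^ k * y₂ x ^ suc k)           ≡⟨ *-identityˡ _ ⟩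
        y₁ x ^ k * y₂ x ^ suc k                  ∎

    -- The head of the list stands for the coefficient of i^(k + 1); the value is the sum over F of
    -- z times the resulting polynomial in i.
    pairing : List Carrier → ℕ → Carrier
    pairing []       k = 0#
    pairing (d ∷ ds) k = d * bit (pascal k (suc k)) + pairing ds (suc k)

    Λ-z-poles : ∀ ds k → k ℕ.+ length ds ≤ q → Λ (λ x → z x * (i x ^ suc k * eval ds (i x))) ≡ pairing ds k
    Λ-z-poles [] k _ = trans (Λ-cong (λ x _ → trans (cong (z x *_) (zeroʳ _)) (zeroʳ _))) Λ-0
    Λ-z-poles (d ∷ ds) k k≤q = begin
      Λ (λ x → z x * (i x ^ suc k * (d + i x * eval ds (i x))))
        ≡⟨ Λ-cong (λ x _ → solve 5 (λ z w d i e → z :* (w :* (d :+ i :* e)) := d :* (z :* w) :+ z :* (i :* w :* e))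
             refl (z x) (i x ^ suc k) d (i x) (eval ds (i x))) ⟩
      Λ (λ x → d * (z x * i x ^ suc k) + z x * (i x ^ suc (suc k) * eval ds (i x)))
        ≡⟨ Λ-distrib-+ (λ x → d * (z x * i x ^ suc k)) (λ x → z x * (i x ^ suc (suc k) * eval ds (i x))) ⟩
      Λ (λ x → d * (z x * i x ^ suc k)) + Λ (λ x → z x * (i x ^ suc (suc k) * eval ds (i x)))
        ≡⟨ cong₂ _+_ (trans (Λ-distribˡ-* d (λ x → z x * i x ^ suc k)) (cong (d *_) (Λ-zi^ k (ℕ.≤-trans (s≤s (ℕ.m≤m+n k (length ds))) k+≤q))))
             (Λ-z-poles ds (suc k) k+≤q) ⟩
      d * bit (pascal k (suc k)) + pairing ds (suc k) ∎
      where
      k+≤q : suc k ℕ.+ length ds ≤ q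
      k+≤q = subst (_≤ q) (ℕ.+-suc k (length ds)) k≤q

    -- As u = z (z + 1), each Horner step contributes two linear factors.
    Deg≤-eval-u : ∀ cs → Deg≤ (length cs ℕ.* 2) (λ x → eval cs (u x))
    Deg≤-eval-u []       = Deg≤-const 0#
    Deg≤-eval-u (c ∷ cs) a a<q = trans
      (Λ-cong (λ x _ → cong (λ v → x ^ a * (c + v)) (solve 3 (λ x ρ e →
        ((x :+ ρ) :* (x :+ ρ) :+ (x :+ ρ)) :* e := (x :+ ρ) :* ((x :+ (ρ :+ con true)) :* e)) refl x ρ (eval cs (u x)))))
      (Deg≤-+ (Deg≤-const {suc (suc (length cs ℕ.* 2))} c) (Deg≤-linear ρ (Deg≤-linear (ρ + 1#) (Deg≤-eval-u cs))) a a<q)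

    -- The polynomial part vanishes by degree and the z-free part by invariance, so only the poles
    -- contribute.
    Λ-evaluate : ∀ cs ds (h : Carrier → Carrier → Carrier) → length cs ≤ 11 → length ds ≤ 32 →
                 Λ (λ x → z x * (eval cs (u x) + i x * eval ds (i x)) + h (u x) (i x)) ≡ pairing ds 0
    Λ-evaluate cs ds h cs≤11 ds≤32 = begin
      Λ (λ x → z x * (eval cs (u x) + i x * eval ds (i x)) + h (u x) (i x))
        ≡⟨ Λ-cong (λ x _ → cong (_+ h (u x) (i x)) (solve 4 (λ z c i d →
             z :* (c :+ i :* d) := z :* c :+ z :* (i :* con true :* d)) refl (z x) (eval cs (u x)) (i x) (eval ds (i x)))) ⟩
      Λ (λ x → z x * eval cs (u x) + z x * (i x ^ 1 * eval ds (i x)) + h (u x) (i x))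
        ≡⟨ Λ-distrib-+ (λ x → z x * eval cs (u x) + z x * (i x ^ 1 * eval ds (i x))) (λ x → h (u x) (i x)) ⟩
      Λ (λ x → z x * eval cs (u x) + z x * (i x ^ 1 * eval ds (i x))) + Λ (λ x → h (u x) (i x))
        ≡⟨ cong₂ _+_ (Λ-distrib-+ (λ x → z x * eval cs (u x)) (λ x → z x * (i x ^ 1 * eval ds (i x))))
             (Λ-invariant (λ x → h (u x) (i x)) (λ x _ → cong₂ h (u-shift x) (i-shift x))) ⟩
      Λ (λ x → z x * eval cs (u x)) + Λ (λ x → z x * (i x ^ 1 * eval ds (i x))) + 0#
        ≡⟨ cong₂ (λ v w → v + w + 0#) (Deg≤⇒Λ≡0 (Deg≤-linear ρ (Deg≤-eval-u cs)) small)
             (Λ-z-poles ds 0 (ℕ.≤-trans ds≤32 32≤q)) ⟩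
      0# + pairing ds 0 + 0#
        ≡⟨ trans (+-identityʳ _) (+-identityˡ _) ⟩
      pairing ds 0 ∎
      where
      -- At most 11 coefficients give z T(u) the degree bound 1 + 22, and 24 < 32.
      small : suc (suc (length cs ℕ.* 2)) < q
      small = ℕ.≤-trans (s≤s (s≤s (s≤s (ℕ.*-monoˡ-≤ 2 cs≤11)))) (ℕ.≤-trans (ℕ.m≤m+n 25 7) 32≤q)

    -- Constraints on a permutation in normal form.

    module NormalForm (A B : Carrier) (π : PermutationOfF)
                      (π≡ : ∀ {x} → InF x → PermutationOfF.fun π x ≡ A * (x * x) + B * x + y₁ x + y₂ x) where
      open PermutationOfF π

      ε c : Carrier
      ε = A + B
      c = A * (ρ * ρ) + B * ρ

      -- The constant c completes A x² + B x to A z² + B z = A u + (A + B) z.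
      π+c : ∀ {x} → InF x → fun x + c ≡ A * u x + i x + ε * z x
      π+c {x} x∈F = trans (cong (_+ c) (π≡ x∈F)) (solve 6 (λ A B x ρ y₁ y₂ → let z = x :+ ρ in
        A :* (x :* x) :+ B :* x :+ y₁ :+ y₂ :+ (A :* (ρ :* ρ) :+ B :* ρ) :=
        A :* (z :* z :+ z) :+ (y₁ :+ y₂) :+ (A :+ B) :* z) refl A B x ρ (y₁ x) (y₂ x))

      -- Reindexing by the permutation leaves the sum of (x + c)^k, a polynomial of degree k ≤ q - 2
      -- with coefficients in E.
      Λ-g^k≡0 : ∀ k → suc k < 32 → Λ (λ x → (A * u x + i x + ε * z x) ^ k) ≡ 0#
      Λ-g^k≡0 k k<32 = begin
        Λ (λ x → (A * u x + i x + ε * z x) ^ k)   ≡⟨ Λ-cong (λ x x∈F → cong (_^ k) (sym (π+c x∈F))) ⟩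
        Λ (λ x → (fun x + c) ^ k)                 ≡⟨ Λ-permute π (λ x → (x + c) ^ k) ⟩
        Λ (λ x → (x + c) ^ k)                     ≡⟨ Deg≤⇒Λ≡0 (Deg≤-power c k) (ℕ.≤-trans k<32 32≤q) ⟩
        0#                                        ∎

      z²≡z+u : ∀ x → z x * z x ≡ z x + u x
      z²≡z+u x = solve 1 (λ z → z :* z := z :+ (z :* z :+ z)) refl (z x)

      -- In the cube, z i and z i² carry the coefficients ε² and ε, and both sum to 1 over F.
      ε+ε²≡0 : ε * (ε + 1#) ≡ 0#
      ε+ε²≡0 = begin
        ε * (ε + 1#)
          ≡⟨ solve 1 (λ ε → ε :* (ε :+ con true) := ε :* ε :* con true :+ (ε :* con true :+ con false)) refl ε ⟩
        pairing (ε * ε ∷ ε ∷ []) 0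
          ≡⟨ Λ-evaluate (ε * ε * ε ∷ ε * ε * A + ε * ε * ε ∷ ε * (A * A) ∷ []) (ε * ε ∷ ε ∷ [])
               (λ u i → (A * u + i) * ((A * u + i) * (A * u + i) + ε * ε * u) + u * (ε * (ε * ε)))
               (ℕ.m≤m+n 3 8) (ℕ.m≤m+n 2 30) ⟨
        _ ≡⟨ Λ-cong (λ x _ → sym (cube (z²≡z+u x) A ε (i x))) ⟩
        Λ (λ x → (A * u x + i x + ε * z x) ^ 3)
          ≡⟨ Λ-g^k≡0 3 (ℕ.m≤m+n 5 27) ⟩
        0# ∎

      -- Passing from 0 to 1 exchanges the two fractions and changes the quadratic part by A + B, so
      -- ε = 0 contradicts injectivity.
      ε≢0 : ε ≢ 0#
      ε≢0 ε≡0 = 0≢1 (trans (sym (inv-fun F-0)) (trans (cong inv fun0≡fun1) (inv-fun F-1)))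
        where
        fun0≡fun1 : fun 0# ≡ fun 1#
        fun0≡fun1 = begin
          fun 0#
            ≡⟨ π≡ F-0 ⟩
          A * (0# * 0#) + B * 0# + y₁ 0# + y₂ 0#
            ≡⟨ cong₂ (λ v w → A * (0# * 0#) + B * 0# + v + w) (trans (sym (y₂-shift 0#)) (cong y₂ (+-identityˡ 1#)))
                 (trans (sym (y₁-shift 0#)) (cong y₁ (+-identityˡ 1#))) ⟩
          A * (0# * 0#) + B * 0# + y₂ 1# + y₁ 1#
            ≡⟨ solve 4 (λ A B v w → A :* (con false :* con false) :+ B :* con false :+ w :+ v :=
                 (A :* (con true :* con true) :+ B :* con true :+ v :+ w) :+ (A :+ B)) refl A B (y₁ 1#) (y₂ 1#) ⟩
          A * (1# * 1#) + B * 1# + y₁ 1# + y₂ 1# + ε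
            ≡⟨ trans (cong (A * (1# * 1#) + B * 1# + y₁ 1# + y₂ 1# +_) ε≡0) (+-identityʳ _) ⟩
          A * (1# * 1#) + B * 1# + y₁ 1# + y₂ 1#
            ≡⟨ π≡ F-1 ⟨
          fun 1# ∎

      ε≡1 : ε ≡ 1#
      ε≡1 = x+y≡0⇒x≡y (x≢0∧xy≡0⇒y≡0 ε≢0 ε+ε²≡0)

      A≡0 : A ≡ 0#
      A≡0 = begin
        A
          -- The right-hand factors are the bits `pascal k (suc k)` for k from 0 to 9, equal to 1
          -- exactly at k = 0, 1, 3, 7. The entries selected from `polePart A 1#` are 1 + 1 + A, 1,
          -- 0 and 1, with sum A.
          ≡⟨ solve 1 (λ A → let 0' = con false ; 1' = con true in
               A := (1' :+ 1' :+ A :* 1') :* 1' :+ (1' :* 1' :+ (1' :* 0' :+ (0' :* 1' :+ (0' :* 0' :+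
               (A :* A :* (1' :* 1') :* 0' :+ ((1' :+ A :* 1') :* 0' :+ (1' :* 1' :+ (1' :* 0' :+ (1' :* 0' :+ 0')))))))))) refl A ⟩
        pairing (polePart A 1#) 0
          ≡⟨ Λ-evaluate (polyPart A 1#) (polePart A 1#) (invariantPart A) ℕ.≤-refl (ℕ.m≤m+n 10 22) ⟨
        _ ≡⟨ Λ-cong (λ x x∈F → sym (trans
               (cong (λ v → (A * u x + i x + v) ^ 11) (trans (cong (_* z x) ε≡1) (*-identityˡ (z x))))
               (eleventh-power (z²≡z+u x) A (i x) (u*i≡1 x∈F)))) ⟩
        Λ (λ x → (A * u x + i x + ε * z x) ^ 11)
          ≡⟨ Λ-g^k≡0 11 (ℕ.m≤m+n 13 19) ⟩
        0# ∎

  -- Reduction of f to the normal form.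

  infixr 9 _∘ₚ_
  _∘ₚ_ : PermutationOfF → PermutationOfF → PermutationOfF
  σ ∘ₚ τ = record
    { fun = σ.fun ∘ τ.fun
    ; inv = τ.inv ∘ σ.inv
    ; fun∈F = σ.fun∈F ∘ τ.fun∈F
    ; inv∈F = τ.inv∈F ∘ σ.inv∈F
    ; fun-inv = λ x∈F → trans (cong σ.fun (τ.fun-inv (σ.inv∈F x∈F))) (σ.fun-inv x∈F)
    ; inv-fun = λ x∈F → trans (cong τ.inv (σ.inv-fun (τ.fun∈F x∈F))) (τ.inv-fun x∈F)
    }
    where
    module σ = PermutationOfF σ
    module τ = PermutationOfF τ

  bijective⇒permutationOfF : (f : Carrier → Carrier) → (∀ {x} → InF x → InF (f x)) →
    (∀ {x y} → InF x → InF y → f x ≡ f y → x ≡ y) →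
    (∀ {y} → InF y → Σ Carrier λ x → InF x × f x ≡ y) → PermutationOfF
  bijective⇒permutationOfF f f∈F f-inj f-surj = record
    { fun = f ; inv = inv ; fun∈F = f∈F ; inv∈F = inv∈F ; fun-inv = fun-inv
    ; inv-fun = λ x∈F → f-inj (inv∈F (f∈F x∈F)) x∈F (fun-inv (f∈F x∈F)) }
    where
    inv : Carrier → Carrier
    inv y with (y ^ q) ≟ y
    ... | yes y∈F = proj₁ (f-surj y∈F)
    ... | no _    = y
    inv∈F : ∀ {y} → InF y → InF (inv y)
    inv∈F {y} y∈F with (y ^ q) ≟ y
    ... | yes y∈F' = proj₁ (proj₂ (f-surj y∈F'))
    ... | no y∉F   = contradiction y∈F y∉F
    fun-inv : ∀ {y} → InF y → f (inv y) ≡ y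
    fun-inv {y} y∈F with (y ^ q) ≟ y
    ... | yes y∈F' = proj₂ (proj₂ (f-surj y∈F'))
    ... | no y∉F   = contradiction y∈F y∉F

  module _ (a b r : Carrier) (a≢0 : a ≢ 0#) (r∉F : r ^ q ≢ r) where

    -- The trace t of r lies in F; in characteristic two it is also r - r^q, hence nonzero. Dividing
    -- by it makes the trace of ρ equal to 1.
    s t ρ : Carrier
    s = r ^ q
    t = r + s
    ρ = t ⁻¹ * r

    s∉F : ¬ InF s
    s∉F s∈F = r∉F (trans (sym s∈F) ([x^q]^q≡x r))

    t∈F : InF t
    t∈F = begin
      (r + s) ^ q    ≡⟨ ^q-distrib-+ r s ⟩
      s + s ^ q      ≡⟨ cong (s +_) ([x^q]^q≡x r) ⟩
      s + r          ≡⟨ +-comm s r ⟩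
      r + s          ∎

    t≢0 : t ≢ 0#
    t≢0 t≡0 = r∉F (sym (x+y≡0⇒x≡y t≡0))

    t*ρ≡r : t * ρ ≡ r
    t*ρ≡r = trans (sym (*-assoc t (t ⁻¹) r)) (trans (cong (_* r) (inverseʳ t t≢0)) (*-identityˡ r))

    t*[ρ+1]≡s : t * (ρ + 1#) ≡ s
    t*[ρ+1]≡s = begin
      t * (ρ + 1#)   ≡⟨ distribˡ t ρ 1# ⟩
      t * ρ + t * 1# ≡⟨ cong₂ _+_ t*ρ≡r (*-identityʳ t) ⟩
      r + (r + s)    ≡⟨ solve 2 (λ r s → r :+ (r :+ s) := s) refl r s ⟩
      s              ∎

    ρ^q≡ρ+1 : ρ ^ q ≡ ρ + 1#
    ρ^q≡ρ+1 = *-cancelʳ t≢0 (begin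
      ρ ^ q * t              ≡⟨ cong (ρ ^ q *_) t∈F ⟨
      ρ ^ q * t ^ q          ≡⟨ ^-distrib-* ρ t q ⟨
      (ρ * t) ^ q            ≡⟨ cong (_^ q) (trans (*-comm ρ t) t*ρ≡r) ⟩
      s                      ≡⟨ t*[ρ+1]≡s ⟨
      t * (ρ + 1#)           ≡⟨ *-comm t (ρ + 1#) ⟩
      (ρ + 1#) * t           ∎)

    value : Carrier → Carrier
    value x = a * x ^ 2 + b * x + (x - r) ⁻¹ + (x - s) ⁻¹

    fMap-value : ∀ {x} → InF x → fMap E a b r s (just x) ≡ just (value x)
    fMap-value {x} x∈F with x ≟ r | x ≟ s
    ... | yes x≡r | _       = contradiction (subst InF x≡r x∈F) r∉F
    ... | no _    | yes x≡s = contradiction (subst InF x≡s x∈F) s∉F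
    ... | no _    | no _    = refl

    -- The outer factor t cancels the t in the denominators t x - r = t (x + ρ) and t x - s = t (x +
    -- ρ + 1).
    normal-form : ∀ {x} → InF x → t * value (t * x) ≡
      a * (t * t * t) * (x * x) + b * (t * t) * x + (x + ρ) ⁻¹ + (x + (ρ + 1#)) ⁻¹
    normal-form {x} x∈F = begin
      t * value (t * x)
        ≡⟨ solve 6 (λ t a b x v w → t :* (a :* (t :* x :* (t :* x :* con true)) :+ b :* (t :* x) :+ v :+ w) :=
             a :* (t :* t :* t) :* (x :* x) :+ b :* (t :* t) :* x :+ t :* v :+ t :* w) refl t a b x ((t * x - r) ⁻¹) ((t * x - s) ⁻¹) ⟩
      a * (t * t * t) * (x * x) + b * (t * t) * x + t * (t * x - r) ⁻¹ + t * (t * x - s) ⁻¹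
        ≡⟨ cong₂ (λ v w → a * (t * t * t) * (x * x) + b * (t * t) * x + v + w)
             (scale-⁻¹ r ρ t*ρ≡r r∉F) (scale-⁻¹ s (ρ + 1#) t*[ρ+1]≡s s∉F) ⟩
      a * (t * t * t) * (x * x) + b * (t * t) * x + (x + ρ) ⁻¹ + (x + (ρ + 1#)) ⁻¹ ∎
      where
      scale-⁻¹ : ∀ r' ρ' → t * ρ' ≡ r' → ¬ InF r' → t * (t * x - r') ⁻¹ ≡ (x + ρ') ⁻¹
      scale-⁻¹ r' ρ' tρ'≡r' r'∉F = sym (⁻¹-unique (begin
        (x + ρ') * (t * (t * x - r') ⁻¹)
          ≡⟨ solve 4 (λ x ρ t v → (x :+ ρ) :* (t :* v) := (t :* x :+ t :* ρ) :* v) refl x ρ' t ((t * x - r') ⁻¹) ⟩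
        (t * x + t * ρ') * (t * x - r') ⁻¹
          ≡⟨ cong (λ v → (t * x + v) * (t * x - r') ⁻¹) (trans tρ'≡r' (sym (-x≡x r'))) ⟩
        (t * x - r') * (t * x - r') ⁻¹
          ≡⟨ inverseʳ _ (λ eq → r'∉F (subst InF (trans (x+y≡0⇒x≡y eq) (-x≡x r')) (F-* t∈F x∈F))) ⟩
        1# ∎))

    not-permutation : ¬ PermutesP¹Sub E q (fMap E a b r s)
    not-permutation (mapsTo , injective , surjective) =
      -- The contradiction is a t³ = 0 with a and t nonzero.
      *-nonzero a≢0 (*-nonzero (*-nonzero t≢0 t≢0) t≢0)
        (Poles.NormalForm.A≡0 ρ ρ^q≡ρ+1 (a * (t * t * t)) (b * (t * t))
          (scaling t≢0 t∈F ∘ₚ bijective⇒permutationOfF value value∈F value-inj value-surj ∘ₚ scaling t≢0 t∈F)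
          normal-form)
      where
      value∈F : ∀ {x} → InF x → InF (value x)
      value∈F {x} x∈F = subst (InP¹Sub E q) (fMap-value x∈F) (mapsTo (just x) x∈F)

      value-inj : ∀ {x y} → InF x → InF y → value x ≡ value y → x ≡ y
      value-inj {x} {y} x∈F y∈F eq = just-injective (injective (just x) (just y) x∈F y∈F
        (trans (fMap-value x∈F) (trans (cong just eq) (sym (fMap-value y∈F)))))

      value-surj : ∀ {y} → InF y → Σ Carrier λ x → InF x × value x ≡ y
      -- A finite point has a finite preimage because ∞ is sent to ∞, which rules out the case
      -- `nothing`.
      value-surj {y} y∈F with surjective (just y) y∈F
      ... | just x , x∈F , eq = x , x∈F , just-injective (trans (sym (fMap-value x∈F)) eq)

theorem4p1 : (n : ℕ) → 5 ≤ n → (E : FiniteField ((2 ℕ.^ n) ℕ.^ 2)) →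
    let open FiniteField E
        q = 2 ℕ.^ n
    in (a b r : Carrier) →
       a ^ q ≡ a → a ≢ 0# →
       (b ≡ 0# ⊎ b ≡ 1#) →
       r ^ q ≢ r →
       ¬ PermutesP¹Sub E q (fMap E a b r (r ^ q))
theorem4p1 n 5≤n E a b r a∈F a≢0 b∈F₂ r∉F = Subfield.not-permutation n 5≤n E a b r a≢0 r∉F
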